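{- If $qS\ge 0$ is a superbalanced facet of $H_n$, then any zero-lift $q'S'\ge 0$ of it is a superbalanced facet of $H_{n+1}$.
   Context: For a positive integer $k$ let $[k]=\{1,\dots,k\}$. $K_N$ is the undirected complete graph on vertex set $[N]$, with edge set $E_N$. A weight map is a function $w:E_N\to\mathbb{R}_{\ge 0}$. For $W\subseteq[N]$, the cut $C(W)$ is the set of edges with exactly one endpoint in $W$, and $\|C(W)\|$ is the sum of the weights of its edges. For $1\le n<N$, $w$ realizes in $K_N$ the vector $S=(S_I)_{\varnothing\ne I\subseteq[n]}\in\mathbb{R}^{2^n-1}$ with $S_I=\min\{\|C(W)\| : W\subseteq[N-1],\ W\cap[n]=I\}$. $H_n$ is the set of all $S\in\mathbb{R}^{2^n-1}$ realized by some weight map in $K_N$ for some $N>n$; it is a full-dimensional convex polyhedral cone. An inequality $qS\ge0$ with $q=(q_I)_{\varnothing\ne I\subseteq[n]}\in\mathbb{R}^{2^n-1}$ means $\sum_I q_IS_I\ge 0$. It is a facet of $H_n$ if it holds for all $S\in H_n$ and $\{S\in H_n: qS=0\}$ is a facet of $H_n$, i.e. has dimension $2^n-2$. The inequality is balanced if $\sum_{I\ni j}q_I=0$ for every $j\in[n]$. The sink is denoted $N\notin[n]$ and $[n;N]=[n]\cup\{N\}$. For a non-empty proper subset $X$ of $[n;N]$ containing $N$ one sets $S_X:=S_{[n;N]\setminus X}$. A permutation $\pi$ of $[n;N]$ sends the inequality $\sum_Iq_IS_I\ge0$ to $\sum_Iq_IS_{\pi(I)}\ge0$. A balanced inequality is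 superbalanced if all inequalities obtained from it by permutations of $[n;N]$ are balanced. Zero-lift: let $K\subseteq[n]$ be the set of terminals appearing in $qS\ge0$ ($i\in K$ iff $q_I\neq0$ for some $I\ni i$). Given a family of pairwise disjoint non-empty subsets $I_i\subseteq[n+1]$, $i\in K$ (whose union need not be $[n+1]$), the corresponding zero-lift $q'S'\ge0$, an inequality over $\mathbb{R}^{2^{n+1}-1}$, is obtained by replacing each term $q_IS_I$ with $q_I\neq0$ by $q_IS'_{\bigcup_{i\in I}I_i}$. -}

module Defs where

open import Algebra.Bundles using (CommutativeRing)
open import Algebra.Structures using (IsCommutativeRing)
import Algebra.Properties.CommutativeMonoid.Sum as FinSum
open import Data.Bool.Base using (if_then_else_; _xor_)
import Data.Bool.Properties as Bool
open import Data.Fin.Base as Fin using (Fin; zero; suc)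
open import Data.Fin.Permutation using (Permutation′; _⟨$⟩ˡ_)
import Data.Fin.Properties as Fin
open import Data.Fin.Subset
  using (Subset; Nonempty; Empty; inside; outside; _∈_; _∩_; ⋃; ∁)
open import Data.Fin.Subset.Properties using (nonempty?; _∈?_)
open import Data.Irrelevant using ([_])
open import Data.List.Base as List using (allFin; filter)
open import Data.Nat.Base as ℕ using (ℕ; zero; suc)
open import Data.Product.Base using (_×_; _,_; proj₁; proj₂; ∃; ∃-syntax)
open import Data.Refinement.Base using (Refinement-syntax; _,_; value)
open import Data.Vec.Base using ([]; _∷_; _∷ʳ_; init; last; lookup; tabulate; take)
import Data.Vec.Properties as Vec
open import Level using (0ℓ)
import Relation.Binary.Construct.NonStrictToStrict as ToStrict
open import Relation.Binary.Definitions using (DecidableEquality)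
open import Relation.Binary.PropositionalEquality using (_≡_; _≢_)
open import Relation.Binary.Structures using (IsDecTotalOrder)
open import Relation.Nullary using (¬_; yes; no; does)

-- The classical axioms of ℝ as a Dedekind-complete ordered field, which
-- determine it up to isomorphism.  Decidability of the order is part of the
-- classical theory.

record Reals : Set₁ where
  infixl 7 _*_
  infixl 6 _+_
  infix  8 -_
  infix  4 _≤_ _<_
  field
    ℝ                 : Set
    _≤_               : ℝ → ℝ → Set
    _+_ _*_           : ℝ → ℝ → ℝ
    -_                : ℝ → ℝ
    0# 1#             : ℝ
    isCommutativeRing : IsCommutativeRing _≡_ _+_ _*_ -_ 0# 1#
    isDecTotalOrder   : IsDecTotalOrder _≡_ _≤_

  _<_ : ℝ → ℝ → Set
  _<_ = ToStrict._<_ _≡_ _≤_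

  field
    0≢1        : 0# ≢ 1#
    *-inverse  : ∀ x → x ≢ 0# → ∃[ y ] x * y ≡ 1#
    +-monoʳ-≤  : ∀ x {y z} → y ≤ z → x + y ≤ x + z
    *-nonneg   : ∀ {x y} → 0# ≤ x → 0# ≤ y → 0# ≤ x * y
    supremum   : (P : ℝ → Set) → ∃ P → (∃[ b ] (∀ x → P x → x ≤ b)) →
                 ∃[ s ] (∀ x → P x → x ≤ s) × (∀ y → y < s → ∃[ x ] P x × y < x)

  commutativeRing : CommutativeRing 0ℓ 0ℓ
  commutativeRing = record { isCommutativeRing = isCommutativeRing }

-- [n] is represented by Fin n, and the index set of ℝ^(2^n-1) by:

NonemptySubset : ℕ → Set
NonemptySubset n = [ I ∈ Subset n ∣ Nonempty I ]

infix 4 _≟ˢ_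
_≟ˢ_ : ∀ {n} → DecidableEquality (Subset n)
_≟ˢ_ = Vec.≡-dec Bool._≟_

Edge : ℕ → Set
Edge N = [ e ∈ Fin N × Fin N ∣ proj₁ e Fin.< proj₂ e ]

-- [n;N] is represented by Fin (suc n), whose last element is the sink.  An
-- X containing the sink stands for its complement, as in S_X = S_{[n;N]∖X}.

embed : ∀ {n} → Subset n → Subset (suc n)
embed I = I ∷ʳ outside

awayFromSink : ∀ {n} → Subset (suc n) → Subset n
awayFromSink X = init (if last X then ∁ X else X)

image : ∀ {n} → Permutation′ n → Subset n → Subset n
image π X = tabulate λ j → lookup X (π ⟨$⟩ˡ j)

unionOver : ∀ {n m} → (Fin n → Subset m) → Subset n → Subset m
unionOver F I = ⋃ (List.map F (filter (_∈? I) (allFin _)))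

module Cuts (R : Reals) where
  open Reals R
  open FinSum (CommutativeRing.+-commutativeMonoid commutativeRing) using (sum)

  Vector : ℕ → Set
  Vector n = NonemptySubset n → ℝ

  sumSubsets : ∀ n → (Subset n → ℝ) → ℝ
  sumSubsets zero    f = f []
  sumSubsets (suc n) f =
    sumSubsets n (λ I → f (outside ∷ I)) + sumSubsets n (λ I → f (inside ∷ I))

  sumNonempty : ∀ {n} → (NonemptySubset n → ℝ) → ℝ
  sumNonempty {n} f = sumSubsets n term
    where
    term : Subset n → ℝ
    term I with nonempty? I
    ... | yes p = f (I , [ p ])
    ... | no  _ = 0#

  infix 7 _∙_
  _∙_ : ∀ {n} → Vector n → Vector n → ℝ
  q ∙ S = sumNonempty λ I → q I * S I

  record WeightMap (N : ℕ) : Set where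
    field
      weight : Edge N → ℝ
      nonneg : ∀ e → 0# ≤ weight e

  cutWeight : ∀ {N} → WeightMap N → Subset N → ℝ
  cutWeight {N} w W = sum λ i → sum λ j → term i j
    where
    term : Fin N → Fin N → ℝ
    term i j with i Fin.<? j
    ... | yes i<j = if lookup W i xor lookup W j
                    then WeightMap.weight w ((i , j) , [ i<j ]) else 0#
    ... | no  _   = 0#

  -- An arbitrary N > n is written as suc (n + k), so that W ⊆ [N-1] is a
  -- Subset (n + k), W ∩ [n] is take n W, and vertex N is the last one.

  Realizes : ∀ n k → WeightMap (suc (n ℕ.+ k)) → Vector n → Set
  Realizes n k w S = ∀ I →
    (∃[ W ] take n W ≡ value I × S I ≡ cutWeight w (embed W)) ×
    (∀ (W : Subset (n ℕ.+ k)) → take n W ≡ value I → S I ≤ cutWeight w (embed W))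

  H : ∀ n → Vector n → Set
  H n S = ∃[ k ] ∃[ w ] Realizes n k w S

  AffinelyIndependent : ∀ {n m} → (Fin m → Vector n) → Set
  AffinelyIndependent {m = m} p = ∀ (c : Fin m → ℝ) →
    sum c ≡ 0# → (∀ I → sum (λ i → c i * p i I) ≡ 0#) → ∀ i → c i ≡ 0#

  HasDimension : ∀ {n} → (Vector n → Set) → ℕ → Set
  HasDimension {n} P d =
    (∃[ p ] (∀ i → P (p i)) × AffinelyIndependent {n} {suc d} p) ×
    (∀ (p : Fin (suc (suc d)) → Vector n) → (∀ i → P (p i)) → ¬ AffinelyIndependent p)

  -- In the following, q stands for the inequality 0# ≤ q ∙ S.

  IsFacet : ∀ {n} → Vector n → Set
  IsFacet {n} q =
    (∀ S → H n S → 0# ≤ q ∙ S) ×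
    HasDimension (λ S → H n S × q ∙ S ≡ 0#) (2 ℕ.^ n ℕ.∸ 2)

  -- Replaces each term q_I S_I by q_I S_{f I} and collects coefficients.

  substituteTerms : ∀ {n m} → (Subset n → Subset m) → Vector n → Vector m
  substituteTerms f q J =
    sumNonempty λ I → if does (f (value I) ≟ˢ value J) then q I else 0#

  permute : ∀ {n} → Permutation′ (suc n) → Vector n → Vector n
  permute π = substituteTerms λ I → awayFromSink (image π (embed I))

  Balanced : ∀ {n} → Vector n → Set
  Balanced {n} q = ∀ (j : Fin n) →
    sumNonempty (λ I → if does (j ∈? value I) then q I else 0#) ≡ 0#

  Superbalanced : ∀ {n} → Vector n → Set
  Superbalanced {n} q = Balanced q × (∀ (π : Permutation′ (suc n)) → Balanced (permute π q))

  Appears : ∀ {n} → Vector n → Fin n → Set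
  Appears q i = ∃[ I ] i ∈ value I × q I ≢ 0#

  -- Only the sets F i with i appearing in q matter; the other values of F
  -- are irrelevant to zeroLift F q and are left unconstrained.

  LiftFamily : ∀ {n} → Vector n → (Fin n → Subset (suc n)) → Set
  LiftFamily q F =
    (∀ i → Appears q i → Nonempty (F i)) ×
    (∀ i j → Appears q i → Appears q j → i ≢ j → Empty (F i ∩ F j))

  zeroLift : ∀ {n} → (Fin n → Subset (suc n)) → Vector n → Vector (suc n)
  zeroLift F = substituteTerms (unionOver F)

-- For terminals u and v let σ(u,v) be the vector of cuts of the single edge uv.
-- Superbalance says that q · σ(u,v) = 0 for all terminals u and v, including
-- the sink: a balance condition at j is the one for j and the sink, and
-- permutations move that pair to any other.
--
-- The family F is a contraction φ of the terminals [n+1;N] onto [n;N], and the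
-- lift q⁺ pairs with S as q pairs with S ∘ φ⁻¹.  Hence superbalance passes to
-- q⁺, and validity follows by contracting networks along φ.  For the dimension
-- it suffices that a vector r annihilating the face of q⁺ is a multiple of q⁺.
-- If J separates terminals s and t with φ s = φ t, then r J = 0: in a star with
-- two heavy spokes at s and t, the minimum cut changes concavely with the weight
-- at s, and its second difference detects only J and supersets of J, so that
-- downward induction on J applies.  Superbalance keeps the star on the face,
-- because on cuts with s and t on the same side it looks like a network without
-- further vertices.  So r lives on preimages under φ and is a functional on
-- ℝ^(2^n-1), which annihilates the face of q, as networks for q reappear on
-- representatives of the sets F i.

module Submission where

open import Defs
open import Algebra.Bundles using (CommutativeRing)
import Algebra.Properties.CommutativeSemigroup as CommutativeSemigroupProperties
import Algebra.Properties.Ring as RingProperties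
import Algebra.Properties.Semiring.Sum as SemiringSum
open import Data.Bool.Base using (Bool; true; false; if_then_else_; _xor_; not; _∧_)
import Data.Bool.Properties as Bool
open import Data.Empty using (⊥-elim-irr)
open import Data.Fin.Base as Fin using (Fin; zero; suc; fromℕ; inject₁; punchIn; punchOut; splitAt; join; combine; remQuot; _↑ˡ_; _↑ʳ_)
open import Data.Fin.Permutation using (Permutation′; _⟨$⟩ˡ_; _⟨$⟩ʳ_; transpose; inverseˡ)
import Data.Fin.Properties as Fin
open import Data.Fin.Relation.Unary.Top using (view; ‵fromℕ; ‵inject₁; view-fromℕ; view-inject₁)
open import Data.Fin.Subset using (Subset; Nonempty; inside; outside; _∈_; _⊆_; ⊥; ∁; ⋃)
open import Data.Fin.Subset.Induction using (⊃-wellFounded; Acc; acc)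
open import Data.Fin.Subset.Properties using (nonempty?; _∈?_; ∉⊥; Empty-unique; ⊆-antisym; x∈p∪q⁻; x∈p∪q⁺; x∈p∩q⁺)
open import Data.Irrelevant using ([_])
open import Data.List.Base as List using (List; []; _∷_; _++_; concat; tabulate; length; filter; allFin)
open import Data.List.Membership.Propositional using () renaming (_∈_ to _∈ᴸ_)
open import Data.List.Membership.Propositional.Properties using (∈-filter⁺; ∈-filter⁻; ∈-allFin)
open import Data.List.Relation.Unary.All as All using (All; []; _∷_)
import Data.List.Relation.Unary.All.Properties as All
open import Data.List.Relation.Unary.Any using (here; there)
open import Data.Maybe.Base as Maybe using (Maybe; just; nothing)
open import Data.Nat.Base as ℕ using (ℕ; zero; suc; s≤s; z≤n; _⊓_; NonZero)
import Data.Nat.Properties as ℕ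
open import Data.Nat.Tactic.RingSolver using (solve-∀)
open import Data.Product.Base using (_×_; _,_; proj₁; proj₂; ∃-syntax; Σ-syntax)
open import Data.Refinement.Base using (_,_; value)
open import Data.Sum.Base using (_⊎_; inj₁; inj₂; [_,_]′)
open import Data.Vec.Base as Vec using ([]; _∷_; _∷ʳ_; init; last; lookup; take; drop)
open import Data.Vec.Functional using () renaming (_∷_ to _∷ᶠ_)
import Data.Vec.Properties as Vec
open import Function.Base using (_∘_)
open import Relation.Binary.Definitions using (tri<; tri≈; tri>)
open import Relation.Binary.PropositionalEquality
open import Relation.Binary.Structures using (IsDecTotalOrder)
open import Relation.Nullary using (¬_; yes; no; does; Dec; contradiction; ¬?)
open import Relation.Nullary.Decidable using (dec-true; dec-false; decidable-stable)

-- Subsets of terminals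

-- [n;N] is Maybe (Fin n) here, with nothing as the sink.
side : ∀ {n} → Subset n → Maybe (Fin n) → Bool
side I (just i) = lookup I i
side I nothing  = outside

terminal : ∀ {n} → Fin (suc n) → Maybe (Fin n)
terminal i with view i
... | ‵fromℕ     = nothing
... | ‵inject₁ j = just j

position : ∀ {n} → Maybe (Fin n) → Fin (suc n)
position (just i) = inject₁ i
position nothing  = fromℕ _

terminal-position : ∀ {n} (u : Maybe (Fin n)) → terminal (position u) ≡ u
terminal-position (just i) rewrite view-inject₁ i = refl
terminal-position {n} nothing rewrite view-fromℕ n = refl

lookup-∷ʳ-inject₁ : ∀ {n} {A : Set} (xs : Vec.Vec A n) x i → lookup (xs ∷ʳ x) (inject₁ i) ≡ lookup xs i
lookup-∷ʳ-inject₁ (y ∷ xs) x zero    = refl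
lookup-∷ʳ-inject₁ (y ∷ xs) x (suc i) = lookup-∷ʳ-inject₁ xs x i

lookup-∷ʳ-fromℕ : ∀ {n} {A : Set} (xs : Vec.Vec A n) x → lookup (xs ∷ʳ x) (fromℕ n) ≡ x
lookup-∷ʳ-fromℕ []       x = refl
lookup-∷ʳ-fromℕ (y ∷ xs) x = lookup-∷ʳ-fromℕ xs x

lookup-embed : ∀ {n} (I : Subset n) k → lookup (embed I) k ≡ side I (terminal k)
lookup-embed I k with view k
... | ‵fromℕ     = lookup-∷ʳ-fromℕ I outside
... | ‵inject₁ i = lookup-∷ʳ-inject₁ I outside i

lookup-init : ∀ {n} {A : Set} (xs : Vec.Vec A (suc n)) i → lookup (init xs) i ≡ lookup xs (inject₁ i)
lookup-init (x ∷ y ∷ xs) zero    = refl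
lookup-init (x ∷ y ∷ xs) (suc i) = lookup-init (y ∷ xs) i

last-lookup : ∀ {n} {A : Set} (xs : Vec.Vec A (suc n)) → last xs ≡ lookup xs (fromℕ n)
last-lookup (x ∷ [])     = refl
last-lookup (x ∷ y ∷ xs) = last-lookup (y ∷ xs)

-- Complementing exactly when the sink is inside adds the side of the sink modulo 2.
lookup-awayFromSink : ∀ {n} (X : Subset (suc n)) j →
  lookup (awayFromSink X) j ≡ lookup X (inject₁ j) xor lookup X (fromℕ n)
lookup-awayFromSink {n} X j rewrite sym (last-lookup X) with last X
... | true  = trans (lookup-init (∁ X) j) (trans (Vec.lookup-map (inject₁ j) not X) (sym (Bool.xor-comm (lookup X (inject₁ j)) true)))
... | false = trans (lookup-init X j) (sym (Bool.xor-identityʳ _))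

does-∈? : ∀ {n} (i : Fin n) (I : Subset n) → does (i ∈? I) ≡ lookup I i
does-∈? zero    (true ∷ I)  = refl
does-∈? zero    (false ∷ I) = refl
does-∈? (suc i) (b ∷ I)     = does-∈? i I

⊥-empty : ∀ {n} → ¬ Nonempty (⊥ {n})
⊥-empty (_ , i∈⊥) = ∉⊥ i∈⊥

∅-outside : ∀ {n} {I : Subset n} → ¬ Nonempty I → ∀ u → side I u ≡ outside
∅-outside {I = I} I≡∅ (just i) = Bool.¬-not λ Ii → I≡∅ (i , Vec.lookup⇒[]= i I Ii)
∅-outside I≡∅ nothing  = refl

-- Enumeration of the subsets by `Fin (2 ℕ.^ n)`

bit : Bool → Fin 2
bit false = zero
bit true  = suc zero

unbit : Fin 2 → Bool
unbit zero    = false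
unbit (suc _) = true

code : ∀ {n} → Subset n → Fin (2 ℕ.^ n)
code []      = zero
code (b ∷ I) = combine (bit b) (code I)

decode : ∀ n → Fin (2 ℕ.^ n) → Subset n
decode zero    _ = []
decode (suc n) k = let b , j = remQuot {2} (2 ℕ.^ n) k in unbit b ∷ decode n j

decode-combine : ∀ {n} b (j : Fin (2 ℕ.^ n)) → decode (suc n) (combine b j) ≡ unbit b ∷ decode n j
decode-combine {n} b j = cong (λ (b , j) → unbit b ∷ decode n j) (Fin.remQuot-combine b j)

unbit-bit : ∀ b → unbit (bit b) ≡ b
unbit-bit true  = refl
unbit-bit false = refl

bit-unbit : ∀ b → bit (unbit b) ≡ b
bit-unbit zero       = refl
bit-unbit (suc zero) = refl

decode-code : ∀ {n} (I : Subset n) → decode n (code I) ≡ I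
decode-code []      = refl
decode-code (b ∷ I) = trans (decode-combine (bit b) (code I)) (cong₂ _∷_ (unbit-bit b) (decode-code I))

code-decode : ∀ n k → code (decode n k) ≡ k
code-decode zero    zero = refl
code-decode (suc n) k    = let b , j = remQuot {2} (2 ℕ.^ n) k in
  trans (cong₂ combine (bit-unbit b) (code-decode n j)) (Fin.combine-remQuot {2} (2 ℕ.^ n) k)

-- For positive `n` the truncated subtraction in the dimension of a facet is exact.
2+[2^n∸2] : ∀ n .{{_ : NonZero n}} → suc (suc (2 ℕ.^ n ℕ.∸ 2)) ≡ 2 ℕ.^ n
2+[2^n∸2] n = ℕ.m+[n∸m]≡n (ℕ.^-monoʳ-≤ 2 (ℕ.>-nonZero⁻¹ n))

-- Preimages of subsets under maps of terminals, and unions of families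

pull : ∀ {m n} → (Maybe (Fin m) → Maybe (Fin n)) → Subset n → Subset m
pull φ I = Vec.tabulate λ j → side I (φ (just j))

-- A `Subset` always leaves the sink outside, so `pull φ I` is the full preimage of `I` once `φ`
-- fixes the sink.
side-pull : ∀ {m n} (φ : Maybe (Fin m) → Maybe (Fin n)) → φ nothing ≡ nothing →
  ∀ I u → side (pull φ I) u ≡ side I (φ u)
side-pull φ φ∞ I (just j)              = Vec.lookup∘tabulate _ j
side-pull φ φ∞ I nothing  rewrite φ∞ = refl

∈-side : ∀ {n} {I : Subset n} u → side I u ≡ true → ∃[ i ] u ≡ just i × lookup I i ≡ true
∈-side (just i) eq = i , refl , eq

side⇒nonempty : ∀ {n} {I : Subset n} u → side I u ≡ true → Nonempty I
side⇒nonempty {I = I} u eq = let i , _ , Ii = ∈-side u eq in i , Vec.lookup⇒[]= i I Ii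

pull-nonempty : ∀ {m n} (φ : Maybe (Fin m) → Maybe (Fin n)) I → Nonempty (pull φ I) → Nonempty I
pull-nonempty φ I (j , j∈) = side⇒nonempty (φ (just j)) (trans (sym (Vec.lookup∘tabulate _ j)) (Vec.[]=⇒lookup j∈))

side-injective : ∀ {n} {I J : Subset n} → (∀ i → lookup I i ≡ lookup J i) → I ≡ J
side-injective {I = I} {J} eq = trans (sym (Vec.tabulate∘lookup I)) (trans (Vec.tabulate-cong eq) (Vec.tabulate∘lookup J))

∈-⋃⁻ : ∀ {m n} (F : Fin m → Subset n) is {j} → j ∈ ⋃ (List.map F is) → ∃[ i ] i ∈ᴸ is × j ∈ F i
∈-⋃⁻ F []       j∈ = contradiction j∈ ∉⊥
∈-⋃⁻ F (i ∷ is) j∈ with x∈p∪q⁻ (F i) _ j∈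
... | inj₁ j∈Fi = i , here refl , j∈Fi
... | inj₂ j∈⋃  = let i′ , i′∈ , j∈Fi′ = ∈-⋃⁻ F is j∈⋃ in i′ , there i′∈ , j∈Fi′

∈-⋃⁺ : ∀ {m n} (F : Fin m → Subset n) {is i j} → i ∈ᴸ is → j ∈ F i → j ∈ ⋃ (List.map F is)
∈-⋃⁺ F (here refl) j∈Fi = x∈p∪q⁺ (inj₁ j∈Fi)
∈-⋃⁺ F (there i∈)  j∈Fi = x∈p∪q⁺ (inj₂ (∈-⋃⁺ F i∈ j∈Fi))

∈-unionOver⁻ : ∀ {m n} (F : Fin m → Subset n) I {j} → j ∈ unionOver F I → ∃[ i ] i ∈ I × j ∈ F i
∈-unionOver⁻ F I j∈ = let i , i∈ , j∈Fi = ∈-⋃⁻ F _ j∈ in i , proj₂ (∈-filter⁻ (_∈? I) {xs = allFin _} i∈) , j∈Fi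

∈-unionOver⁺ : ∀ {m n} (F : Fin m → Subset n) I {i j} → i ∈ I → j ∈ F i → j ∈ unionOver F I
∈-unionOver⁺ F I {i} i∈I j∈Fi = ∈-⋃⁺ F (∈-filter⁺ (_∈? I) (∈-allFin i) i∈I) j∈Fi

true-iff : ∀ {b c} → (b ≡ true → c ≡ true) → (c ≡ true → b ≡ true) → b ≡ c
true-iff {true}          b⇒c c⇒b = sym (b⇒c refl)
true-iff {false} {true}  b⇒c c⇒b = c⇒b refl
true-iff {false} {false} b⇒c c⇒b = refl

-- Cuts in stars

count : ∀ {A : Set} → (A → Bool) → List A → ℕ
count p []       = 0
count p (u ∷ us) = (if p u then 1 else 0) ℕ.+ count p us

count-complement : ∀ {A : Set} (p : A → Bool) us → count p us ℕ.+ count (not ∘ p) us ≡ length us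
count-complement p []       = refl
count-complement p (u ∷ us) with p u
... | true  = cong suc (count-complement p us)
... | false = trans (ℕ.+-suc (count p us) _) (cong suc (count-complement p us))

count-not≡0 : ∀ {A : Set} (p : A → Bool) us → count (not ∘ p) us ≡ 0 → All (λ u → p u ≡ true) us
count-not≡0 p []       _  = []
count-not≡0 p (u ∷ us) eq with p u in pu
... | true = pu ∷ count-not≡0 p us eq

all⇒count-not≡0 : ∀ {A : Set} (p : A → Bool) {us} → All (λ u → p u ≡ true) us → count (not ∘ p) us ≡ 0
all⇒count-not≡0 p []         = refl
all⇒count-not≡0 p (pu ∷ pus) rewrite pu = all⇒count-not≡0 p pus

-- The minimum cut of a star with spokes of weight suc (2 * h) + a at s,
-- suc (2 * h) at t, suc h at the sink and 1 at h further terminals, where σ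
-- and τ are the sides of s and t, and c and c̄ of the h terminals lie inside
-- and outside.

hubOutside : ℕ → ℕ → Bool → Bool → ℕ → ℕ
hubOutside h a σ τ c = (if σ then suc (2 ℕ.* h) ℕ.+ a else 0) ℕ.+ ((if τ then suc (2 ℕ.* h) else 0) ℕ.+ c)

hubInside : ℕ → ℕ → Bool → Bool → ℕ → ℕ
hubInside h a σ τ c̄ = hubOutside h a (not σ) (not τ) (suc h ℕ.+ c̄)

starCut : ℕ → ℕ → Bool → Bool → ℕ → ℕ → ℕ
starCut h a σ τ c c̄ = hubOutside h a σ τ c ⊓ hubInside h a σ τ c̄

-- Minus the second difference of the minimum cut over `a = 0, 1, 2`. It is nonzero only if both
-- sides of the hub cost the same at `a = 1` and the hub changes sides there.
tie : Bool → Bool → ℕ → ℕ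
tie true  false zero = 1
tie _     _     _    = 0

module _ {h c c̄ : ℕ} (c+c̄≡h : c ℕ.+ c̄ ≡ h) where
  private
    A : ℕ
    A = suc (2 ℕ.* h)

    c≤h : c ℕ.≤ h
    c≤h = subst (c ℕ.≤_) c+c̄≡h (ℕ.m≤m+n c c̄)

    c̄≤h : c̄ ℕ.≤ h
    c̄≤h = subst (c̄ ℕ.≤_) c+c̄≡h (ℕ.m≤n+m c̄ c)

    h+c̄<A : suc h ℕ.+ c̄ ℕ.≤ A
    h+c̄<A = s≤s (ℕ.+-monoʳ-≤ h (ℕ.≤-trans c̄≤h (ℕ.m≤m+n h 0)))

  -- A hub outside cuts both heavy spokes, while a hub inside cuts only the spoke at the sink and
  -- `c̄` light ones, at most `A` in all.
  starCut-inside : ∀ a → starCut h a true true c c̄ ≡ suc h ℕ.+ c̄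
  starCut-inside a = ℕ.m≥n⇒m⊓n≡n
    (ℕ.≤-trans h+c̄<A (ℕ.≤-trans (ℕ.m≤m+n A a) (ℕ.m≤m+n (A ℕ.+ a) (A ℕ.+ c))))

  starCut-outside : ∀ a → starCut h a false false c c̄ ≡ c
  starCut-outside a = ℕ.m≤n⇒m⊓n≡m
    (ℕ.≤-trans c≤h (ℕ.≤-trans (ℕ.n≤1+n h) (ℕ.≤-trans (ℕ.m≤m+n (suc h) c̄)
      (ℕ.≤-trans (ℕ.m≤n+m (suc h ℕ.+ c̄) A) (ℕ.m≤n+m (A ℕ.+ (suc h ℕ.+ c̄)) (A ℕ.+ a))))))

  starCut-t : ∀ a → starCut h a false true c c̄ ≡ A ℕ.+ c
  starCut-t a = ℕ.m≤n⇒m⊓n≡m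
    (ℕ.+-mono-≤ (ℕ.m≤m+n A a) (ℕ.≤-trans c≤h (ℕ.≤-trans (ℕ.n≤1+n h) (ℕ.m≤m+n (suc h) c̄))))

  -- The heavy spokes compete here: the hub stays outside with `t` while `a + c` is at most
  -- `suc h + c̄`, which `c + c̄ ≡ h` turns into the bound on `a`. For `c̄ = 0` the bound is 1, and
  -- for larger `c̄` it is at least 3.
  starCut-s : ∀ a → a ℕ.≤ suc (2 ℕ.* c̄) → starCut h a true false c c̄ ≡ A ℕ.+ a ℕ.+ c
  starCut-s a a≤ = ℕ.m≤n⇒m⊓n≡m (subst (ℕ._≤ A ℕ.+ (suc h ℕ.+ c̄)) (sym (ℕ.+-assoc A a c))
    (ℕ.+-monoʳ-≤ A (subst (a ℕ.+ c ℕ.≤_) (trans (rearranged c c̄) (cong (λ h → suc h ℕ.+ c̄) c+c̄≡h)) (ℕ.+-monoˡ-≤ c a≤))))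
    where
    rearranged : ∀ c c̄ → suc (2 ℕ.* c̄) ℕ.+ c ≡ suc (c ℕ.+ c̄) ℕ.+ c̄
    rearranged = solve-∀

  -- The hub has moved inside to `s`, so the cut no longer grows with `a` and keeps its value at
  -- `a = 1`.
  starCut-s-tie : c̄ ≡ 0 → starCut h 2 true false c c̄ ≡ A ℕ.+ 1 ℕ.+ c
  starCut-s-tie refl = trans
    (ℕ.m≥n⇒m⊓n≡n (ℕ.≤-trans (ℕ.≤-reflexive in≡) (ℕ.+-monoˡ-≤ c (ℕ.+-monoʳ-≤ A (s≤s z≤n))))) in≡
    where
    in≡ : A ℕ.+ (suc h ℕ.+ 0) ≡ A ℕ.+ 1 ℕ.+ c
    in≡ = trans (cong (A ℕ.+_) (trans (ℕ.+-identityʳ (suc h)) (cong suc (trans (sym c+c̄≡h) (ℕ.+-identityʳ c))))) (sym (ℕ.+-assoc A 1 c))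

-- On a fixed side of the hub the cut is affine in `a`. Only with `s` inside, `t` outside and
-- `c̄ = 0` does the hub switch sides between `a = 0` and `a = 2`.
starCut-second-difference : ∀ {h} c c̄ → c ℕ.+ c̄ ≡ h → ∀ σ τ →
  starCut h 0 σ τ c c̄ ℕ.+ starCut h 2 σ τ c c̄ ℕ.+ tie σ τ c̄ ≡ starCut h 1 σ τ c c̄ ℕ.+ starCut h 1 σ τ c c̄
starCut-second-difference {h} c c̄ eq σ τ = case σ τ c̄ eq
  where
  evaluate : ∀ {x₀ x₁ x₂ y₀ y₁ y₂ e} → x₀ ≡ y₀ → x₁ ≡ y₁ → x₂ ≡ y₂ →
    y₀ ℕ.+ y₂ ℕ.+ e ≡ y₁ ℕ.+ y₁ → x₀ ℕ.+ x₂ ℕ.+ e ≡ x₁ ℕ.+ x₁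
  evaluate refl refl refl eq = eq
  crossed-tie : ∀ A c → (A ℕ.+ 0 ℕ.+ c) ℕ.+ (A ℕ.+ 1 ℕ.+ c) ℕ.+ 1 ≡ (A ℕ.+ 1 ℕ.+ c) ℕ.+ (A ℕ.+ 1 ℕ.+ c)
  crossed-tie = solve-∀
  crossed : ∀ A c → (A ℕ.+ 0 ℕ.+ c) ℕ.+ (A ℕ.+ 2 ℕ.+ c) ℕ.+ 0 ≡ (A ℕ.+ 1 ℕ.+ c) ℕ.+ (A ℕ.+ 1 ℕ.+ c)
  crossed = solve-∀
  case : ∀ σ τ c̄ → c ℕ.+ c̄ ≡ h →
    starCut h 0 σ τ c c̄ ℕ.+ starCut h 2 σ τ c c̄ ℕ.+ tie σ τ c̄ ≡ starCut h 1 σ τ c c̄ ℕ.+ starCut h 1 σ τ c c̄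
  case true  true  c̄ eq = evaluate (starCut-inside {c = c} eq 0) (starCut-inside {c = c} eq 1) (starCut-inside {c = c} eq 2) (ℕ.+-identityʳ _)
  case false false c̄ eq = evaluate (starCut-outside {c̄ = c̄} eq 0) (starCut-outside {c̄ = c̄} eq 1) (starCut-outside {c̄ = c̄} eq 2) (ℕ.+-identityʳ _)
  case false true  c̄ eq = evaluate (starCut-t {c̄ = c̄} eq 0) (starCut-t {c̄ = c̄} eq 1) (starCut-t {c̄ = c̄} eq 2) (ℕ.+-identityʳ _)
  case true  false zero      eq = evaluate (starCut-s eq 0 z≤n) (starCut-s eq 1 (s≤s z≤n)) (starCut-s-tie eq refl) (crossed-tie (suc (2 ℕ.* h)) c)
  case true  false (suc c̄)  eq = evaluate (starCut-s eq 0 z≤n) (starCut-s eq 1 (s≤s z≤n)) (starCut-s eq 2 2≤) (crossed (suc (2 ℕ.* h)) c)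
    where
    2≤ : 2 ℕ.≤ suc (2 ℕ.* suc c̄)
    2≤ = s≤s (s≤s z≤n)

elements : ∀ {n} → Subset n → List (Fin n)
elements J = filter (_∈? J) (allFin _)

-- Vertices of networks

Vertex : ℕ → ℕ → Set
Vertex n k = Maybe (Fin n) ⊎ Fin k

vertexSide : ∀ {n k} → Subset n → Subset k → Vertex n k → Bool
vertexSide I T = [ side I , lookup T ]′

index : ∀ {n k} → Vertex n k → Fin (suc (n ℕ.+ k))
index {n} {k} (inj₁ u) = position (Maybe.map (_↑ˡ k) u)
index {n} {k} (inj₂ v) = position (just (n ↑ʳ v))

vertex : ∀ {n k} → Fin (suc (n ℕ.+ k)) → Vertex n k
vertex {n} i with terminal i
... | nothing = inj₁ nothing
... | just j  with splitAt n j
...   | inj₁ u = inj₁ (just u)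
...   | inj₂ v = inj₂ v

lookup-position : ∀ {n} (I : Subset n) u → lookup (embed I) (position u) ≡ side I u
lookup-position I u = trans (lookup-embed I (position u)) (cong (side I) (terminal-position u))

lookup-index : ∀ {n k} (I : Subset n) (T : Subset k) v →
  lookup (embed (I Vec.++ T)) (index v) ≡ vertexSide I T v
lookup-index {k = k} I T (inj₁ (just u)) = trans (lookup-position (I Vec.++ T) (just (u ↑ˡ k))) (Vec.lookup-++ˡ I T u)
lookup-index I T (inj₁ nothing)  = lookup-position (I Vec.++ T) nothing
lookup-index {n} I T (inj₂ v)    = trans (lookup-position (I Vec.++ T) (just (n ↑ʳ v))) (Vec.lookup-++ʳ I T v)

lookup-vertex : ∀ {n k} (I : Subset n) (T : Subset k) i →
  lookup (embed (I Vec.++ T)) i ≡ vertexSide I T (vertex i)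
lookup-vertex {n} I T i rewrite lookup-embed (I Vec.++ T) i with terminal i
... | nothing = refl
... | just j  rewrite Vec.lookup-splitAt n I T j with splitAt n j
...   | inj₁ _ = refl
...   | inj₂ _ = refl

take-++ : ∀ {n k} (I : Subset n) (T : Subset k) → take n (I Vec.++ T) ≡ I
take-++ {n} I T = Vec.++-injectiveˡ _ I (Vec.take++drop≡id n (I Vec.++ T))

++-drop : ∀ {n k I} (W : Subset (n ℕ.+ k)) → take n W ≡ I → I Vec.++ drop n W ≡ W
++-drop {n} W refl = Vec.take++drop≡id n W

module ZeroLifts (R : Reals) where
  open Reals R
  open Cuts R
  open CommutativeRing commutativeRing using
    ( ring; semiring; +-commutativeSemigroup; *-commutativeSemigroup; +-identityˡ; +-identityʳ; +-assoc; +-comm; -‿inverseˡ; -‿inverseʳ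
    ; *-identityˡ; *-identityʳ; *-assoc; *-comm; zeroˡ; zeroʳ; distribˡ; distribʳ )
  open RingProperties ring using (-‿distribˡ-*; -‿distribʳ-*; -‿involutive)
  open CommutativeSemigroupProperties +-commutativeSemigroup using (interchange)
  open CommutativeSemigroupProperties *-commutativeSemigroup using (x∙yz≈y∙xz)
  open SemiringSum semiring using (sum; ∑-distrib-+; sum-cong-≗; *-distribˡ-sum; sum-remove; sum-replicate-zero)
  open IsDecTotalOrder isDecTotalOrder using () renaming
    ( _≟_ to _≟ℝ_; _≤?_ to _≤?ℝ_; refl to ≤-refl; trans to ≤-trans; antisym to ≤-antisym; total to ≤-total )

  -- Vectors indexed by subsets

  sumSubsets-cong : ∀ n {f g : Subset n → ℝ} → (∀ I → f I ≡ g I) → sumSubsets n f ≡ sumSubsets n g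
  sumSubsets-cong zero    f≗g = f≗g []
  sumSubsets-cong (suc n) f≗g =
    cong₂ _+_ (sumSubsets-cong n λ I → f≗g (outside ∷ I)) (sumSubsets-cong n λ I → f≗g (inside ∷ I))

  sumSubsets-zero : ∀ n {f : Subset n → ℝ} → (∀ I → f I ≡ 0#) → sumSubsets n f ≡ 0#
  sumSubsets-zero zero    f≗0 = f≗0 []
  sumSubsets-zero (suc n) f≗0 =
    trans (cong₂ _+_ (sumSubsets-zero _ λ I → f≗0 (outside ∷ I)) (sumSubsets-zero _ λ I → f≗0 (inside ∷ I)))
          (+-identityˡ 0#)

  sumSubsets-+ : ∀ {n} (f g : Subset n → ℝ) →
    sumSubsets n (λ I → f I + g I) ≡ sumSubsets n f + sumSubsets n g
  sumSubsets-+ {zero}  f g = refl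
  sumSubsets-+ {suc n} f g =
    trans (cong₂ _+_ (sumSubsets-+ (λ I → f (outside ∷ I)) (λ I → g (outside ∷ I)))
                     (sumSubsets-+ (λ I → f (inside ∷ I)) (λ I → g (inside ∷ I))))
          (interchange _ _ _ _)

  sumSubsets-*ˡ : ∀ {n} x (f : Subset n → ℝ) →
    sumSubsets n (λ I → x * f I) ≡ x * sumSubsets n f
  sumSubsets-*ˡ {zero}  x f = refl
  sumSubsets-*ˡ {suc n} x f =
    trans (cong₂ _+_ (sumSubsets-*ˡ x (λ I → f (outside ∷ I))) (sumSubsets-*ˡ x (λ I → f (inside ∷ I))))
          (sym (distribˡ x _ _))

  sumSubsets-comm : ∀ {m n} (f : Subset m → Subset n → ℝ) →
    sumSubsets m (λ I → sumSubsets n (f I)) ≡ sumSubsets n (λ J → sumSubsets m (λ I → f I J))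
  sumSubsets-comm {zero}  f = refl
  sumSubsets-comm {suc m} {n} f =
    trans (cong₂ _+_ (sumSubsets-comm (λ I → f (outside ∷ I))) (sumSubsets-comm (λ I → f (inside ∷ I))))
          (sym (sumSubsets-+ {n} _ _))

  sumSubsets-sum-comm : ∀ {m n} (f : Subset m → Fin n → ℝ) →
    sumSubsets m (λ I → sum (f I)) ≡ sum (λ j → sumSubsets m (λ I → f I j))
  sumSubsets-sum-comm {zero}  f = refl
  sumSubsets-sum-comm {suc m} {n} f =
    trans (cong₂ _+_ (sumSubsets-sum-comm (λ I → f (outside ∷ I))) (sumSubsets-sum-comm (λ I → f (inside ∷ I))))
          (sym (∑-distrib-+ {n} _ _))

  sumSubsets-single : ∀ {n} (J : Subset n) {f : Subset n → ℝ} →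
    (∀ I → I ≢ J → f I ≡ 0#) → sumSubsets n f ≡ f J
  sumSubsets-single []            f≗0 = refl
  sumSubsets-single (outside ∷ J) f≗0 =
    trans (cong₂ _+_ (sumSubsets-single J λ I I≢J → f≗0 (outside ∷ I) (I≢J ∘ Vec.∷-injectiveʳ))
                     (sumSubsets-zero _ λ I → f≗0 (inside ∷ I) λ ()))
          (+-identityʳ _)
  sumSubsets-single (inside ∷ J)  f≗0 =
    trans (cong₂ _+_ (sumSubsets-zero _ λ I → f≗0 (outside ∷ I) λ ())
                     (sumSubsets-single J λ I I≢J → f≗0 (inside ∷ I) (I≢J ∘ Vec.∷-injectiveʳ)))
          (+-identityˡ _)

  infix 7 _·_
  _·_ : ∀ {n} → (Subset n → ℝ) → (Subset n → ℝ) → ℝ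
  f · g = sumSubsets _ λ I → f I * g I

  ·-comm : ∀ {n} (f g : Subset n → ℝ) → f · g ≡ g · f
  ·-comm f g = sumSubsets-cong _ λ I → *-comm (f I) (g I)

  -- Vectors are extended by 0 at the empty set.
  ⟦_⟧ : ∀ {n} → Vector n → Subset n → ℝ
  ⟦ q ⟧ I with nonempty? I
  ... | yes p = q (I , [ p ])
  ... | no  _ = 0#

  Grounded : ∀ {n} → (Subset n → ℝ) → Set
  Grounded g = ∀ I → ¬ Nonempty I → g I ≡ 0#

  ⟦⟧-grounded : ∀ {n} (q : Vector n) → Grounded ⟦ q ⟧
  ⟦⟧-grounded q I ¬I with nonempty? I
  ... | yes p = contradiction p ¬I
  ... | no  _ = refl

  ⟦⟧-value : ∀ {n} (q : Vector n) I → ⟦ q ⟧ (value I) ≡ q I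
  ⟦⟧-value q (I , [ p ]) with nonempty? I
  ... | yes _ = refl
  ... | no ¬p = ⊥-elim-irr (¬p p)

  ⟦⟧-nonempty : ∀ {n} (q : Vector n) {I} → ⟦ q ⟧ I ≢ 0# → Nonempty I
  ⟦⟧-nonempty q {I} qI≢0 with nonempty? I
  ... | yes p = p
  ... | no  _ = contradiction refl qI≢0

  -- sumNonempty sums a local function of Defs, which only unification can name.
  summand : ∀ {n} {t : Subset n → ℝ} (x : ℝ) → x ≡ sumSubsets n t → Subset n → ℝ
  summand {t = t} _ _ = t

  sumNonempty-⟦⟧ : ∀ {n} (f : Vector n) → sumNonempty f ≡ sumSubsets n ⟦ f ⟧
  sumNonempty-⟦⟧ {n} f = sumSubsets-cong n term
    where
    term : ∀ I → summand (sumNonempty f) refl I ≡ ⟦ f ⟧ I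
    term I with nonempty? I
    ... | yes _ = refl
    ... | no  _ = refl

  ⟦⟧-map₂ : ∀ {n} {h : Subset n → ℝ → ℝ} (q : Vector n) → (∀ I → h I 0# ≡ 0#) →
    ∀ I → ⟦ (λ I → h (value I) (q I)) ⟧ I ≡ h I (⟦ q ⟧ I)
  ⟦⟧-map₂ q h0 I with nonempty? I
  ... | yes _ = refl
  ... | no  _ = sym (h0 I)

  ∙-· : ∀ {n} (q S : Vector n) → q ∙ S ≡ ⟦ q ⟧ · ⟦ S ⟧
  ∙-· {n} q S = trans (sumNonempty-⟦⟧ (λ I → q I * S I)) (sumSubsets-cong n term)
    where
    term : ∀ I → ⟦ (λ I → q I * S I) ⟧ I ≡ ⟦ q ⟧ I * ⟦ S ⟧ I
    term I with nonempty? I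
    ... | yes _ = refl
    ... | no  _ = sym (zeroˡ 0#)

  if-0 : ∀ b → (if b then 0# else 0#) ≡ 0#
  if-0 true  = refl
  if-0 false = refl

  -- Each coefficient of `q` moves to the coordinate `f I`, so after exchanging the two sums only
  -- `J = f I` survives. A term with `f I` empty has no coordinate and is dropped on the left; on
  -- the right it is 0 because `g` is grounded.
  substituteTerms-· : ∀ {m n} (f : Subset m → Subset n) (q : Vector m) {g} → Grounded g →
    ⟦ substituteTerms f q ⟧ · g ≡ ⟦ q ⟧ · (g ∘ f)
  substituteTerms-· {m} {n} f q {g} g0 = begin
    ⟦ substituteTerms f q ⟧ · g
      ≡⟨ sumSubsets-cong n collect ⟩
    sumSubsets n (λ J → g J * sumSubsets m (coefficient J))
      ≡⟨ sumSubsets-cong n (λ J → sumSubsets-*ˡ (g J) (coefficient J)) ⟨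
    sumSubsets n (λ J → sumSubsets m λ I → g J * coefficient J I)
      ≡⟨ sumSubsets-comm (λ J I → g J * coefficient J I) ⟩
    sumSubsets m (λ I → sumSubsets n λ J → g J * coefficient J I)
      ≡⟨ sumSubsets-cong m evaluate ⟩
    ⟦ q ⟧ · (g ∘ f) ∎
    where
    open ≡-Reasoning
    coefficient : Subset n → Subset m → ℝ
    coefficient J I = if does (f I ≟ˢ J) then ⟦ q ⟧ I else 0#

    collect : ∀ J → ⟦ substituteTerms f q ⟧ J * g J ≡ g J * sumSubsets m (coefficient J)
    collect J with nonempty? J
    ... | yes p = trans (*-comm _ _) (cong (g J *_) (trans (sumNonempty-⟦⟧ λ I → if does (f (value I) ≟ˢ J) then q I else 0#)
                    (sumSubsets-cong m (⟦⟧-map₂ {h = λ I x → if does (f I ≟ˢ J) then x else 0#} q λ I → if-0 (does (f I ≟ˢ J))))))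
    ... | no ¬p rewrite g0 J ¬p = trans (zeroʳ 0#) (sym (zeroˡ _))

    evaluate : ∀ I → sumSubsets n (λ J → g J * coefficient J I) ≡ ⟦ q ⟧ I * g (f I)
    evaluate I = trans
      (sumSubsets-single (f I) λ J J≢fI →
        trans (cong (λ b → g J * (if b then ⟦ q ⟧ I else 0#)) (dec-false (f I ≟ˢ J) (J≢fI ∘ sym))) (zeroʳ _))
      (trans (cong (λ b → g (f I) * (if b then ⟦ q ⟧ I else 0#)) (dec-true (f I ≟ˢ f I) refl)) (*-comm _ _))

  -- Superbalance as a condition on pairs of terminals

  separation : ∀ {n} → Maybe (Fin n) → Maybe (Fin n) → Subset n → ℝ
  separation u v I = if side I u xor side I v then 1# else 0#

  -- With `separation u v` as the cut vector σ(u,v), this is superbalance freed of permutations.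
  PairBalanced : ∀ {n} → Vector n → Set
  PairBalanced q = ∀ u v → ⟦ q ⟧ · separation u v ≡ 0#

  balance : ∀ {n} (q : Vector n) j →
    sumNonempty (λ I → if does (j ∈? value I) then q I else 0#) ≡ ⟦ q ⟧ · separation (just j) nothing
  balance {n} q j = trans (sumNonempty-⟦⟧ λ I → if does (j ∈? value I) then q I else 0#) (sumSubsets-cong n term)
    where
    term : ∀ I → ⟦ (λ I → if does (j ∈? value I) then q I else 0#) ⟧ I ≡ ⟦ q ⟧ I * separation (just j) nothing I
    term I rewrite Bool.xor-identityʳ (lookup I j) | sym (does-∈? j I) with nonempty? I
    ... | no _  = sym (zeroˡ _)
    ... | yes p with does (j ∈? I)
    ...   | true  = sym (*-identityʳ _)
    ...   | false = sym (zeroʳ _)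

  separation-grounded : ∀ {n} (u v : Maybe (Fin n)) → Grounded (separation u v)
  separation-grounded u v I I≡∅ =
    cong (if_then 1# else 0#) (cong₂ _xor_ (∅-outside I≡∅ u) (∅-outside I≡∅ v))

  -- Whether a set separates two terminals does not change under complementation, so `awayFromSink`
  -- has no effect here and the pair is merely moved back along `π`.
  balance-permute : ∀ {n} (π : Permutation′ (suc n)) (q : Vector n) j →
    ⟦ permute π q ⟧ · separation (just j) nothing ≡
    ⟦ q ⟧ · separation (terminal (π ⟨$⟩ˡ inject₁ j)) (terminal (π ⟨$⟩ˡ fromℕ n))
  balance-permute {n} π q j = trans (substituteTerms-· (λ I → awayFromSink (image π (embed I))) q (separation-grounded (just j) nothing))
    (sumSubsets-cong n λ I → cong (λ b → ⟦ q ⟧ I * (if b then 1# else 0#)) (sides I))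
    where
    open ≡-Reasoning
    sides : ∀ I → lookup (awayFromSink (image π (embed I))) j xor outside ≡
                  side I (terminal (π ⟨$⟩ˡ inject₁ j)) xor side I (terminal (π ⟨$⟩ˡ fromℕ n))
    sides I = begin
      lookup (awayFromSink (image π (embed I))) j xor outside
        ≡⟨ Bool.xor-identityʳ _ ⟩
      lookup (awayFromSink (image π (embed I))) j
        ≡⟨ lookup-awayFromSink (image π (embed I)) j ⟩
      lookup (image π (embed I)) (inject₁ j) xor lookup (image π (embed I)) (fromℕ n)
        ≡⟨ cong₂ _xor_ (image-side (inject₁ j)) (image-side (fromℕ n)) ⟩
      side I (terminal (π ⟨$⟩ˡ inject₁ j)) xor side I (terminal (π ⟨$⟩ˡ fromℕ n)) ∎
      where
      image-side : ∀ k → lookup (image π (embed I)) k ≡ side I (terminal (π ⟨$⟩ˡ k))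
      image-side k = trans (Vec.lookup∘tabulate (λ j → lookup (embed I) (π ⟨$⟩ˡ j)) k) (lookup-embed I (π ⟨$⟩ˡ k))

  pairBalanced⇒superbalanced : ∀ {n} (q : Vector n) → PairBalanced q → Superbalanced q
  pairBalanced⇒superbalanced {n} q q-bal =
    (λ j → trans (balance q j) (q-bal (just j) nothing)) ,
    (λ π j → trans (balance (permute π q) j) (trans (balance-permute π q j) (q-bal (terminal (π ⟨$⟩ˡ inject₁ j)) (terminal (π ⟨$⟩ˡ fromℕ n)))))

  -- A transposition taking `v` to the sink turns `u, v` into a pair of a terminal and the sink, to
  -- which balance applies. If `u` and `v` differ, `u` cannot land on the sink; if they agree,
  -- nothing separates them.
  superbalanced⇒pairBalanced : ∀ {n} (q : Vector n) → Superbalanced q → PairBalanced q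
  superbalanced⇒pairBalanced {n} q (_ , q-bal) u v with position u Fin.≟ position v
  ... | yes eq = sumSubsets-zero n λ I →
    trans (cong (⟦ q ⟧ I *_) (cong (if_then 1# else 0#) (trans (cong (side I u xor_) (sym (cong (side I) u≡v))) (Bool.xor-same (side I u))))) (zeroʳ _)
    where
    u≡v : u ≡ v
    u≡v = trans (sym (terminal-position u)) (trans (cong terminal eq) (terminal-position v))
  ... | no neq = transported (π ⟨$⟩ʳ position u) refl
    where
    π = transpose (position v) (fromℕ n)
    π-v : π ⟨$⟩ʳ position v ≡ fromℕ n
    π-v rewrite dec-true (position v Fin.≟ position v) refl = refl
    undo : ∀ w {k} → π ⟨$⟩ʳ position w ≡ k → terminal (π ⟨$⟩ˡ k) ≡ w
    undo w eq = trans (cong terminal (trans (cong (π ⟨$⟩ˡ_) (sym eq)) (inverseˡ π))) (terminal-position w)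
    transported : ∀ k → π ⟨$⟩ʳ position u ≡ k → ⟦ q ⟧ · separation u v ≡ 0#
    transported k eq with view k
    ... | ‵fromℕ = contradiction
      (trans (sym (inverseˡ π)) (trans (cong (π ⟨$⟩ˡ_) (trans eq (sym π-v))) (inverseˡ π))) neq
    ... | ‵inject₁ j =
      trans (cong₂ (λ u v → ⟦ q ⟧ · separation u v) (sym (undo u eq)) (sym (undo v π-v)))
            (trans (sym (balance-permute π q j)) (trans (sym (balance (permute π q) j)) (q-bal π j)))

  -- Linear algebra

  +-nonneg : ∀ {x y} → 0# ≤ x → 0# ≤ y → 0# ≤ x + y
  +-nonneg {x} {y} 0≤x 0≤y = ≤-trans 0≤x (subst (_≤ x + y) (+-identityʳ x) (+-monoʳ-≤ x 0≤y))

  0≤1 : 0# ≤ 1#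
  0≤1 with ≤-total 0# 1#
  ... | inj₁ 0≤1 = 0≤1
  ... | inj₂ 1≤0 = subst (0# ≤_) square (*-nonneg 0≤-1 0≤-1)
    where
    0≤-1 : 0# ≤ - 1#
    0≤-1 = subst₂ _≤_ (-‿inverseˡ 1#) (+-identityʳ _) (+-monoʳ-≤ (- 1#) 1≤0)
    square : (- 1#) * (- 1#) ≡ 1#
    square = trans (sym (-‿distribˡ-* 1# (- 1#))) (trans (cong -_ (*-identityˡ (- 1#))) (-‿involutive 1#))

  -- The supremum of {0} ∪ {1 | A} is at least 1 exactly when A holds.
  excluded-middle : (A : Set) → Dec A
  excluded-middle A with supremum P (0# , inj₁ refl) (1# , bounded)
    where
    P : ℝ → Set
    P x = x ≡ 0# ⊎ (x ≡ 1# × A)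
    bounded : ∀ x → P x → x ≤ 1#
    bounded x (inj₁ refl)       = 0≤1
    bounded x (inj₂ (refl , _)) = ≤-refl
  ... | s , upper , least with 1# ≤?ℝ s
  ...   | no 1≰s  = no λ a → 1≰s (upper 1# (inj₂ (refl , a)))
  ...   | yes 1≤s with least 0# (≤-trans 0≤1 1≤s , λ { refl → 0≢1 (≤-antisym 0≤1 1≤s) })
  ...     | x , inj₁ refl , (_ , 0≢0) = contradiction refl 0≢0
  ...     | x , inj₂ (_ , a) , _      = yes a

  *-cancel-0 : ∀ {x y} → x ≢ 0# → x * y ≡ 0# → y ≡ 0#
  *-cancel-0 {x} {y} x≢0 xy≡0 with *-inverse x x≢0
  ... | z , xz≡1 = begin
    y           ≡⟨ *-identityˡ y ⟨
    1# * y      ≡⟨ cong (_* y) (trans (*-comm z x) xz≡1) ⟨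
    z * x * y   ≡⟨ *-assoc z x y ⟩
    z * (x * y) ≡⟨ cong (z *_) xy≡0 ⟩
    z * 0#      ≡⟨ zeroʳ z ⟩
    0#          ∎
    where open ≡-Reasoning

  +-cancel-0 : ∀ {x y} → x ≡ 0# → x + y ≡ 0# → y ≡ 0#
  +-cancel-0 {y = y} refl x+y≡0 = trans (sym (+-identityˡ y)) x+y≡0

  sum-cong : ∀ n {f g : Fin n → ℝ} → (∀ i → f i ≡ g i) → sum f ≡ sum g
  sum-cong n f≗g = sum-cong-≗ f≗g

  sum-zero : ∀ n {f : Fin n → ℝ} → (∀ i → f i ≡ 0#) → sum f ≡ 0#
  sum-zero n f≗0 = trans (sum-cong-≗ f≗0) (sum-replicate-zero n)

  sum-single : ∀ {n} (j : Fin n) (f : Fin n → ℝ) → (∀ i → i ≢ j → f i ≡ 0#) → sum f ≡ f j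
  sum-single {suc n} j f f≗0 = trans (sum-remove {i = j} f)
    (trans (cong (f j +_) (sum-zero n λ i → f≗0 (punchIn j i) (Fin.punchInᵢ≢i j i))) (+-identityʳ _))

  sum-↑ : ∀ a {b} (f : Fin (a ℕ.+ b) → ℝ) →
    sum f ≡ sum (λ i → f (i ↑ˡ b)) + sum (λ i → f (a ↑ʳ i))
  sum-↑ zero    f = sym (+-identityˡ _)
  sum-↑ (suc a) f = trans (cong (f zero +_) (sum-↑ a (f ∘ suc))) (sym (+-assoc _ _ _))

  sumSubsets-decode : ∀ n (f : Subset n → ℝ) → sumSubsets n f ≡ sum (f ∘ decode n)
  sumSubsets-decode zero    f = sym (+-identityʳ _)
  sumSubsets-decode (suc n) f = sym (begin
    sum g
      ≡⟨ sum-↑ (2 ℕ.^ n) g ⟩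
    sum {2 ℕ.^ n} (λ i → g (i ↑ˡ _)) + sum {2 ℕ.^ n ℕ.+ 0} (λ i → g (2 ℕ.^ n ↑ʳ i))
      ≡⟨ cong (sum {2 ℕ.^ n} (λ i → g (i ↑ˡ _)) +_) (trans (sum-↑ (2 ℕ.^ n) (λ i → g (2 ℕ.^ n ↑ʳ i))) (+-identityʳ _)) ⟩
    sum {2 ℕ.^ n} (λ i → g (i ↑ˡ _)) + sum {2 ℕ.^ n} (λ i → g (2 ℕ.^ n ↑ʳ (i ↑ˡ 0)))
      ≡⟨ cong₂ _+_ (sum-cong (2 ℕ.^ n) λ i → cong f (decode-combine {n} zero i))
                   (sum-cong (2 ℕ.^ n) λ i → cong f (decode-combine {n} (suc zero) i)) ⟩
    sum {2 ℕ.^ n} (λ i → f (outside ∷ decode n i)) + sum {2 ℕ.^ n} (λ i → f (inside ∷ decode n i))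
      ≡⟨ cong₂ _+_ (sumSubsets-decode n (λ I → f (outside ∷ I))) (sumSubsets-decode n (λ I → f (inside ∷ I))) ⟨
    sumSubsets (suc n) f ∎)
    where
    open ≡-Reasoning
    g = f ∘ decode (suc n)

  -- Gaussian elimination of the first unknown: if its column is zero, it is set to 1 and the others
  -- to 0; otherwise a pivot row eliminates it from the remaining rows.
  homogeneous : ∀ {e u} → e ℕ.≤ u → (A : Fin e → Fin (suc u) → ℝ) →
    Σ[ c ∈ (Fin (suc u) → ℝ) ] (∃[ j ] c j ≢ 0#) × ∀ i → sum (λ j → A i j * c j) ≡ 0#
  homogeneous {e} {u} e≤u A with Fin.any? (λ i → ¬? (A i zero ≟ℝ 0#))
  ... | no ¬pivot = c , (zero , 0≢1 ∘ sym) , λ i →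
    trans (cong₂ _+_ (trans (cong (_* 1#) (column i)) (zeroˡ 1#)) (sum-zero u λ j → zeroʳ (A i (suc j)))) (+-identityʳ 0#)
    where
    c : Fin (suc u) → ℝ
    c zero    = 1#
    c (suc _) = 0#
    column : ∀ i → A i zero ≡ 0#
    column i = decidable-stable (A i zero ≟ℝ 0#) λ A≢0 → ¬pivot (i , A≢0)
  homogeneous {suc e} {suc u} (s≤s e≤u) A | yes (i₀ , pivot≢0) with *-inverse (A i₀ zero) pivot≢0
  ... | y , ay≡1 with homogeneous e≤u (λ i j → A (punchIn i₀ i) (suc j) + - (A (punchIn i₀ i) zero * y) * A i₀ (suc j))
  ...   | c , (j₁ , cj₁≢0) , solves = c⁺ , (suc j₁ , cj₁≢0) , solves⁺
    where
    open ≡-Reasoning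
    s = sum (λ j → A i₀ (suc j) * c j)
    c⁺ : Fin (suc (suc u)) → ℝ
    -- The value forced by the pivot row: `y` inverts the pivot and `s` is the rest of that row.
    c⁺ zero    = - (y * s)
    c⁺ (suc j) = c j

    eliminated : ∀ i → sum (λ j → A (punchIn i₀ i) (suc j) * c j) + - (A (punchIn i₀ i) zero * y) * s ≡ 0#
    eliminated i = begin
      sum (λ j → b j * c j) + x * s
        ≡⟨ cong (sum (λ j → b j * c j) +_) (*-distribˡ-sum x (λ j → A i₀ (suc j) * c j)) ⟩
      sum (λ j → b j * c j) + sum (λ j → x * (A i₀ (suc j) * c j))
        ≡⟨ ∑-distrib-+ (λ j → b j * c j) (λ j → x * (A i₀ (suc j) * c j)) ⟨
      sum (λ j → b j * c j + x * (A i₀ (suc j) * c j))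
        ≡⟨ sum-cong (suc u) (λ j → trans (cong (b j * c j +_) (sym (*-assoc x (A i₀ (suc j)) (c j)))) (sym (distribʳ (c j) (b j) _))) ⟩
      sum (λ j → (b j + x * A i₀ (suc j)) * c j)
        ≡⟨ solves i ⟩
      0# ∎
      where
      b : Fin (suc u) → ℝ
      b j = A (punchIn i₀ i) (suc j)
      x = - (A (punchIn i₀ i) zero * y)

    rearrange : ∀ a → a * - (y * s) ≡ - (a * y) * s
    rearrange a = trans (sym (-‿distribʳ-* a (y * s))) (trans (cong -_ (sym (*-assoc a y s))) (-‿distribˡ-* (a * y) s))

    solves⁺ : ∀ i → A i zero * - (y * s) + sum (λ j → A i (suc j) * c j) ≡ 0#
    solves⁺ i with i Fin.≟ i₀
    ... | yes refl = trans (cong (_+ s) (trans (rearrange (A i zero)) (trans (cong (λ z → - z * s) ay≡1)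
                       (trans (sym (-‿distribˡ-* 1# s)) (cong -_ (*-identityˡ s)))))) (-‿inverseˡ s)
    ... | no i≢i₀ = subst (λ i → A i zero * - (y * s) + sum (λ j → A i (suc j) * c j) ≡ 0#)
                      (Fin.punchIn-punchOut (i≢i₀ ∘ sym))
                      (row (punchOut (i≢i₀ ∘ sym)))
      where
      row : ∀ k → A (punchIn i₀ k) zero * - (y * s) + sum (λ j → A (punchIn i₀ k) (suc j) * c j) ≡ 0#
      row k = trans (cong (_+ sum (λ j → A (punchIn i₀ k) (suc j) * c j)) (rearrange (A (punchIn i₀ k) zero))) (trans (+-comm _ _) (eliminated k))

  homogeneous-< : ∀ {e u} → e ℕ.< u → (A : Fin e → Fin u → ℝ) →
    Σ[ c ∈ (Fin u → ℝ) ] (∃[ j ] c j ≢ 0#) × ∀ i → sum (λ j → A i j * c j) ≡ 0#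
  homogeneous-< {u = suc u} (s≤s e≤u) A = homogeneous e≤u A

  annihilator : ∀ {n e} → e ℕ.< 2 ℕ.^ n → (A : Fin e → Subset n → ℝ) →
    Σ[ r ∈ (Subset n → ℝ) ] (∃[ I ] r I ≢ 0#) × ∀ i → r · A i ≡ 0#
  annihilator {n} e< A with homogeneous-< e< (λ i j → A i (decode n j))
  ... | c , (j , cj≢0) , solves = c ∘ code ,
    (decode n j , cj≢0 ∘ trans (cong c (sym (code-decode n j)))) , λ i →
    trans (·-comm (c ∘ code) (A i)) (trans (sumSubsets-decode n (λ I → A i I * c (code I)))
      (trans (sum-cong (2 ℕ.^ n) λ j → cong (λ k → A i (decode n j) * c k) (code-decode n j)) (solves i)))

  dependent : ∀ {n u} → 2 ℕ.^ n ℕ.< u → (v : Fin u → Subset n → ℝ) →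
    Σ[ c ∈ (Fin u → ℝ) ] (∃[ j ] c j ≢ 0#) × ∀ I → sum (λ j → c j * v j I) ≡ 0#
  dependent {n} {u} u> v with homogeneous-< u> (λ k j → v j (decode n k))
  ... | c , nontrivial , solves = c , nontrivial , λ I →
    trans (sum-cong u λ j → trans (*-comm (c j) (v j I)) (cong (λ J → v j J * c j) (sym (decode-code I)))) (solves (code I))

  δ : ∀ {n} → Subset n → Subset n → ℝ
  δ J I = if does (J ≟ˢ I) then 1# else 0#

  δ-same : ∀ {n} (J : Subset n) → δ J J ≡ 1#
  δ-same J = cong (if_then 1# else 0#) (dec-true (J ≟ˢ J) refl)

  δ-distinct : ∀ {n} {J I : Subset n} → J ≢ I → δ J I ≡ 0#
  δ-distinct {J = J} {I} J≢I = cong (if_then 1# else 0#) (dec-false (J ≟ˢ I) J≢I)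

  ·-δ : ∀ {n} (r : Subset n → ℝ) J → r · δ J ≡ r J
  ·-δ r J = trans (sumSubsets-single J λ I I≢J → trans (cong (r I *_) (δ-distinct (I≢J ∘ sym))) (zeroʳ (r I)))
                  (trans (cong (r J *_) (δ-same J)) (*-identityʳ (r J)))

  -- Linear and affine independence

  LinearlyIndependent : ∀ {n m} → (Fin m → Vector n) → Set
  LinearlyIndependent {n} {m} p = ∀ (c : Fin m → ℝ) →
    (∀ I → sum (λ i → c i * ⟦ p i ⟧ I) ≡ 0#) → ∀ i → c i ≡ 0#

  ·-combination : ∀ {n m} (r : Subset n → ℝ) (c : Fin m → ℝ) (v : Fin m → Subset n → ℝ) →
    r · (λ I → sum (λ i → c i * v i I)) ≡ sum (λ i → c i * (r · v i))
  ·-combination {n} {m} r c v = begin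
    sumSubsets n (λ I → r I * sum (λ i → c i * v i I))
      ≡⟨ sumSubsets-cong n (λ I → trans (*-distribˡ-sum (r I) (λ i → c i * v i I)) (sum-cong m λ i → x∙yz≈y∙xz (r I) (c i) (v i I))) ⟩
    sumSubsets n (λ I → sum (λ i → c i * (r I * v i I)))
      ≡⟨ sumSubsets-sum-comm (λ I i → c i * (r I * v i I)) ⟩
    sum (λ i → sumSubsets n (λ I → c i * (r I * v i I)))
      ≡⟨ sum-cong m (λ i → sumSubsets-*ˡ (c i) (λ I → r I * v i I)) ⟩
    sum (λ i → c i * (r · v i)) ∎
    where
    open ≡-Reasoning

  ·-combination-zero : ∀ {n m} (r : Subset n → ℝ) (c : Fin m → ℝ) (v : Fin m → Subset n → ℝ) →
    (∀ i → r · v i ≡ 0#) → r · (λ I → sum (λ i → c i * v i I)) ≡ 0#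
  ·-combination-zero {m = m} r c v r·v≡0 = trans (·-combination r c v)
    (sum-zero m λ i → trans (cong (c i *_) (r·v≡0 i)) (zeroʳ (c i)))

  annihilator₂ : ∀ {n k e} → k ℕ.+ e ℕ.< 2 ℕ.^ n → (A : Fin k → Subset n → ℝ) (B : Fin e → Subset n → ℝ) →
    Σ[ r ∈ (Subset n → ℝ) ] (∃[ I ] r I ≢ 0#) × (∀ i → r · A i ≡ 0#) × (∀ j → r · B j ≡ 0#)
  annihilator₂ {n} {k} {e} k+e< A B = r , r≢0 ,
    (λ i → trans (cong (λ x → r · [ A , B ]′ x) (sym (Fin.splitAt-↑ˡ k i e))) (r⊥ (i ↑ˡ e))) ,
    (λ j → trans (cong (λ x → r · [ A , B ]′ x) (sym (Fin.splitAt-↑ʳ k e j))) (r⊥ (k ↑ʳ j)))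
    where
    found = annihilator k+e< (λ i → [ A , B ]′ (splitAt k i))
    r   = proj₁ found
    r≢0 = proj₁ (proj₂ found)
    r⊥  = proj₂ (proj₂ found)

  -- Applying `r` to a linear relation leaves only the term of `S`, whose coefficient must therefore
  -- be 0.
  extend-independent : ∀ {n k} (r : Subset n → ℝ) (S : Vector n) (p : Fin k → Vector n) →
    r · ⟦ S ⟧ ≢ 0# → (∀ i → r · ⟦ p i ⟧ ≡ 0#) →
    LinearlyIndependent p → LinearlyIndependent (S ∷ᶠ p)
  extend-independent {n} {k} r S p r·S≢0 r·p≡0 p-ind c vanishes = λ { zero → c₀≡0 ; (suc i) → p-ind (c ∘ suc) rest i }
    where
    c₀≡0 : c zero ≡ 0#
    c₀≡0 = *-cancel-0 r·S≢0 (trans (*-comm _ _) (+-cancel-0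
      (sum-zero k λ i → trans (cong (c (suc i) *_) (r·p≡0 i)) (zeroʳ _))
      (trans (+-comm _ _) (trans (sym (·-combination r c λ i → ⟦ (S ∷ᶠ p) i ⟧))
        (sumSubsets-zero n λ I → trans (cong (r I *_) (vanishes I)) (zeroʳ (r I)))))))
    rest : ∀ I → sum (λ i → c (suc i) * ⟦ p i ⟧ I) ≡ 0#
    rest I = +-cancel-0 (trans (cong (_* ⟦ S ⟧ I) c₀≡0) (zeroˡ _)) (vanishes I)

  -- Greedy choice: while there is room, some nonzero `r` annihilates the vectors chosen so far and
  -- vanishes on `D`. By hypothesis it does not annihilate all of `P`, so an `S` in `P` with
  -- `r · ⟦ S ⟧ ≢ 0#` extends the family.
  independent-family : ∀ {n e} (D : Fin e → Subset n) (P : Vector n → Set) →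
    (∀ r → (∀ S → P S → r · ⟦ S ⟧ ≡ 0#) → (∀ i → r (D i) ≡ 0#) → ∀ I → r I ≡ 0#) →
    ∀ k → k ℕ.+ e ℕ.≤ 2 ℕ.^ n → ∃[ p ] (∀ i → P (p i)) × LinearlyIndependent {n} {k} p
  independent-family D P spans zero    k≤ = (λ ()) , (λ ()) , λ c _ ()
  independent-family {n} {e} D P spans (suc k) k< =
    let p , Pp , p-ind = independent-family D P spans k (ℕ.<⇒≤ k<)
        r , (I , rI≢0) , r⊥p , r⊥δ = annihilator₂ k< (λ i → ⟦ p i ⟧) (λ j → δ (D j))
        S , PS , r·S≢0 = detect r I rI≢0 r⊥δ
    in S ∷ᶠ p , (λ { zero → PS ; (suc i) → Pp i }) , extend-independent r S p r·S≢0 r⊥p p-ind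
    where
    detect : ∀ r I → r I ≢ 0# → (∀ j → r · δ (D j) ≡ 0#) → ∃[ S ] P S × r · ⟦ S ⟧ ≢ 0#
    detect r I rI≢0 r⊥δ = decidable-stable (excluded-middle _) λ ¬S → rI≢0 (spans r
      (λ S PS → decidable-stable (r · ⟦ S ⟧ ≟ℝ 0#) λ r·S≢0 → ¬S (S , PS , r·S≢0))
      (λ j → trans (sym (·-δ r (D j))) (r⊥δ j)) I)

  -- The origin adds nothing to a relation, so the other coefficients vanish, and then the sum
  -- condition removes its own.
  affinelyIndependent-0∷ : ∀ {n k} (p : Fin (suc k) → Vector n) → (∀ I → p zero I ≡ 0#) →
    LinearlyIndependent (p ∘ suc) → AffinelyIndependent p
  affinelyIndependent-0∷ {n} {k} p p₀≡0 p-ind c Σc≡0 vanishes = λ { zero → c₀≡0 ; (suc i) → rest i }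
    where
    vanishes⁺ : ∀ I → sum (λ i → c (suc i) * ⟦ p (suc i) ⟧ I) ≡ 0#
    vanishes⁺ I with nonempty? I
    ... | yes q = +-cancel-0 (trans (cong (c zero *_) (p₀≡0 (I , [ q ]))) (zeroʳ _)) (vanishes (I , [ q ]))
    ... | no _  = sum-zero k λ i → zeroʳ (c (suc i))
    rest : ∀ i → c (suc i) ≡ 0#
    rest = p-ind (c ∘ suc) vanishes⁺
    c₀≡0 : c zero ≡ 0#
    c₀≡0 = +-cancel-0 (sum-zero k rest) (trans (+-comm _ _) Σc≡0)

  -- The empty set is not a coordinate of a Vector, so that its coordinate in
  -- Subset n → ℝ is free to hold the affine coordinate 1.
  affine : ∀ {n} → Vector n → Subset n → ℝ
  affine S I with nonempty? I
  ... | yes p = S (I , [ p ])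
  ... | no  _ = 1#

  affine-nonempty : ∀ {n} (S : Vector n) {I} → Nonempty I → affine S I ≡ ⟦ S ⟧ I
  affine-nonempty S {I} p with nonempty? I
  ... | yes _ = refl
  ... | no ¬p = contradiction p ¬p

  affine-empty : ∀ {n} (S : Vector n) {I} → ¬ Nonempty I → affine S I ≡ 1#
  affine-empty S {I} ¬p with nonempty? I
  ... | yes p = contradiction p ¬p
  ... | no _  = refl

  -- Otherwise the δ (D j) and the affine p i would be linearly dependent.
  affinelyIndependent-bound : ∀ {n e u} (p : Fin u → Vector n) → AffinelyIndependent p →
    (D : Fin e → Subset n) → (∀ j → Nonempty (D j)) → (∀ i j → D i ≡ D j → i ≡ j) →
    (∀ (a : Fin u → ℝ) → (∀ I → (∀ j → D j ≢ I) → sum (λ i → a i * ⟦ p i ⟧ I) ≡ 0#) →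
       ∀ j → sum (λ i → a i * ⟦ p i ⟧ (D j)) ≡ 0#) →
    e ℕ.+ u ℕ.≤ 2 ℕ.^ n
  affinelyIndependent-bound {n} {e} {u} p p-ind D D≢∅ D-inj determined = ℕ.≮⇒≥ λ 2ⁿ< →
    let c , (k , ck≢0) , vanishes = dependent 2ⁿ< v in ck≢0 (c≡0 c vanishes k)
    where
    rows : Fin e ⊎ Fin u → Subset n → ℝ
    rows (inj₁ j) = δ (D j)
    rows (inj₂ i) = affine (p i)
    v : Fin (e ℕ.+ u) → Subset n → ℝ
    v k = rows (splitAt e k)
    module _ (c : Fin (e ℕ.+ u) → ℝ) (vanishes : ∀ I → sum (λ k → c k * v k I) ≡ 0#) where
      d : Fin e → ℝ
      d j = c (j ↑ˡ u)
      a : Fin u → ℝ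
      a i = c (e ↑ʳ i)
      split : ∀ I → sum (λ j → d j * δ (D j) I) + sum (λ i → a i * affine (p i) I) ≡ 0#
      split I = trans (cong₂ _+_
        (sum-cong e λ j → cong (λ y → d j * rows y I) (sym (Fin.splitAt-↑ˡ e j u)))
        (sum-cong u λ i → cong (λ y → a i * rows y I) (sym (Fin.splitAt-↑ʳ e u i))))
        (trans (sym (sum-↑ e (λ k → c k * v k I))) (vanishes I))
      off-D : ∀ I → (∀ j → D j ≢ I) → sum (λ i → a i * affine (p i) I) ≡ 0#
      off-D I I∉D = +-cancel-0 (sum-zero e λ j → trans (cong (d j *_) (δ-distinct (I∉D j))) (zeroʳ (d j))) (split I)
      affine-⟦⟧ : ∀ I → Nonempty I → sum (λ i → a i * affine (p i) I) ≡ sum (λ i → a i * ⟦ p i ⟧ I)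
      affine-⟦⟧ I I≢∅ = sum-cong u λ i → cong (a i *_) (affine-nonempty (p i) I≢∅)
      ⟦⟧-off-D : ∀ I → (∀ j → D j ≢ I) → sum (λ i → a i * ⟦ p i ⟧ I) ≡ 0#
      ⟦⟧-off-D I I∉D with excluded-middle (Nonempty I)
      ... | yes I≢∅ = trans (sym (affine-⟦⟧ I I≢∅)) (off-D I I∉D)
      ... | no I≡∅  = sum-zero u λ i → trans (cong (a i *_) (⟦⟧-grounded (p i) I I≡∅)) (zeroʳ (a i))
      ⟦⟧-D : ∀ j → sum (λ i → a i * ⟦ p i ⟧ (D j)) ≡ 0#
      ⟦⟧-D = determined a ⟦⟧-off-D
      ⟦⟧-zero : ∀ I → sum (λ i → a i * ⟦ p i ⟧ I) ≡ 0#
      ⟦⟧-zero I with Fin.any? (λ j → D j ≟ˢ I)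
      ... | yes (j , refl) = ⟦⟧-D j
      ... | no I∉D         = ⟦⟧-off-D I λ j eq → I∉D (j , eq)
      -- All affine vectors are 1 at the empty set, which is none of the `D j`, so this coordinate
      -- reads off the sum.
      Σa≡0 : sum a ≡ 0#
      Σa≡0 = trans (sum-cong u λ i → sym (trans (cong (a i *_) (affine-empty (p i) ⊥-empty)) (*-identityʳ (a i))))
                   (off-D ⊥ λ j Dj≡⊥ → ⊥-empty (subst Nonempty Dj≡⊥ (D≢∅ j)))
      a≡0 : ∀ i → a i ≡ 0#
      a≡0 = p-ind a Σa≡0 λ I → trans (sum-cong u λ i → cong (a i *_) (sym (⟦⟧-value (p i) I))) (⟦⟧-zero (value I))
      d≡0 : ∀ j → d j ≡ 0#
      d≡0 j = begin
        d j
          ≡⟨ trans (cong (d j *_) (δ-same (D j))) (*-identityʳ (d j)) ⟨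
        d j * δ (D j) (D j)
          ≡⟨ sum-single j (λ i → d i * δ (D i) (D j)) (λ i i≢j → trans (cong (d i *_) (δ-distinct (i≢j ∘ D-inj i j))) (zeroʳ (d i))) ⟨
        sum (λ i → d i * δ (D i) (D j))
          ≡⟨ +-cancel-0 (trans (affine-⟦⟧ (D j) (D≢∅ j)) (⟦⟧-D j)) (trans (+-comm _ _) (split (D j))) ⟩
        0# ∎
        where open ≡-Reasoning
      c≡0 : ∀ k → c k ≡ 0#
      c≡0 k = subst (λ k → c k ≡ 0#) (Fin.join-splitAt e u k) (cases (splitAt e k))
        where
        cases : ∀ s → c (join e u s) ≡ 0#
        cases (inj₁ j) = d≡0 j
        cases (inj₂ i) = a≡0 i

  -- Networks

  -- Networks are lists of weighted edges over an arbitrary vertex type. Loops and parallel edges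
  -- are allowed, so that contraction is mere relabelling.
  WeightedEdge : Set → Set
  WeightedEdge V = V × V × ℝ

  crossing : {V : Set} → (V → Bool) → WeightedEdge V → ℝ
  crossing x (u , v , a) = if x u xor x v then a else 0#

  cut : {V : Set} → List (WeightedEdge V) → (V → Bool) → ℝ
  cut []      x = 0#
  cut (e ∷ L) x = crossing x e + cut L x

  Nonnegative : {V : Set} → List (WeightedEdge V) → Set
  Nonnegative = All λ (_ , _ , a) → 0# ≤ a

  relabel : {U V : Set} → (U → V) → List (WeightedEdge U) → List (WeightedEdge V)
  relabel φ = List.map λ (u , v , a) → φ u , φ v , a

  cut-relabel : ∀ {U V : Set} (φ : U → V) L x → cut (relabel φ L) x ≡ cut L (x ∘ φ)
  cut-relabel φ []      x = refl
  cut-relabel φ (e ∷ L) x = cong (crossing (x ∘ φ) e +_) (cut-relabel φ L x)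

  cut-cong : ∀ {V : Set} L {x y : V → Bool} → (∀ v → x v ≡ y v) → cut L x ≡ cut L y
  cut-cong []                x≗y = refl
  cut-cong ((u , v , a) ∷ L) x≗y =
    cong₂ _+_ (cong (if_then a else 0#) (cong₂ _xor_ (x≗y u) (x≗y v))) (cut-cong L x≗y)

  cut-++ : ∀ {V : Set} L M (x : V → Bool) → cut (L ++ M) x ≡ cut L x + cut M x
  cut-++ []      M x = sym (+-identityˡ _)
  cut-++ (e ∷ L) M x = trans (cong (crossing x e +_) (cut-++ L M x)) (sym (+-assoc _ _ _))

  cut-tabulate : ∀ {V : Set} n (f : Fin n → WeightedEdge V) x →
    cut (tabulate f) x ≡ sum (λ i → crossing x (f i))
  cut-tabulate zero    f x = refl
  cut-tabulate (suc n) f x = cong (crossing x (f zero) +_) (cut-tabulate n (f ∘ suc) x)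

  cut-concat-tabulate : ∀ {V : Set} n (f : Fin n → List (WeightedEdge V)) x →
    cut (concat (tabulate f)) x ≡ sum (λ i → cut (f i) x)
  cut-concat-tabulate zero    f x = refl
  cut-concat-tabulate (suc n) f x = trans (cut-++ (f zero) _ x) (cong (cut (f zero) x +_) (cut-concat-tabulate n (f ∘ suc) x))

  edgeWeight : ∀ {N} → WeightMap N → Fin N → Fin N → ℝ
  edgeWeight w i j with i Fin.<? j
  ... | yes i<j = WeightMap.weight w ((i , j) , [ i<j ])
  ... | no _    = 0#

  edgeWeight-nonneg : ∀ {N} (w : WeightMap N) i j → 0# ≤ edgeWeight w i j
  edgeWeight-nonneg w i j with i Fin.<? j
  ... | yes i<j = WeightMap.nonneg w ((i , j) , [ i<j ])
  ... | no _    = ≤-refl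

  -- As with `summand`, unification names the local function of `cutWeight`.
  doubleSummand : ∀ {N} {t : Fin N → Fin N → ℝ} (x : ℝ) → x ≡ sum (λ i → sum (t i)) → Fin N → Fin N → ℝ
  doubleSummand {t = t} _ _ = t

  cutWeight-crossing : ∀ {N} (w : WeightMap N) W →
    cutWeight w W ≡ sum (λ i → sum λ j → crossing (lookup W) (i , j , edgeWeight w i j))
  cutWeight-crossing {N} w W = sum-cong N λ i → sum-cong N λ j → term i j
    where
    term : ∀ i j → doubleSummand (cutWeight w W) refl i j ≡ crossing (lookup W) (i , j , edgeWeight w i j)
    term i j with i Fin.<? j
    ... | yes _ = refl
    ... | no _  = sym (if-0 (lookup W i xor lookup W j))

  edges : ∀ {N} → WeightMap N → List (WeightedEdge (Fin N))
  edges w = concat (tabulate λ i → tabulate λ j → i , j , edgeWeight w i j)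

  edges-nonneg : ∀ {N} (w : WeightMap N) → Nonnegative (edges w)
  edges-nonneg w = All.concat⁺ (All.tabulate⁺ λ i → All.tabulate⁺ λ j → edgeWeight-nonneg w i j)

  cut-edges : ∀ {N} (w : WeightMap N) W → cut (edges w) (lookup W) ≡ cutWeight w W
  cut-edges {N} w W = trans (cut-concat-tabulate N _ (lookup W))
    (trans (sum-cong N λ i → cut-tabulate N (λ j → i , j , edgeWeight w i j) (lookup W)) (sym (cutWeight-crossing w W)))

  -- From edge lists to weight maps

  matching : ∀ {N} → WeightedEdge (Fin N) → Fin N → Fin N → ℝ
  matching (u , v , a) i j = if does (u Fin.≟ i) ∧ does (v Fin.≟ j) then a else 0#

  -- Edges are entered in both orientations because a weight map reads only the entries with
  -- `i < j`. Loops are doubled on the diagonal, which is never read.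
  totalWeight : ∀ {N} → List (WeightedEdge (Fin N)) → Fin N → Fin N → ℝ
  totalWeight []                i j = 0#
  totalWeight ((u , v , a) ∷ L) i j = (matching (u , v , a) i j + matching (v , u , a) i j) + totalWeight L i j

  if-nonneg : ∀ b {a} → 0# ≤ a → 0# ≤ (if b then a else 0#)
  if-nonneg true  0≤a = 0≤a
  if-nonneg false _   = ≤-refl

  totalWeight-nonneg : ∀ {N} {L : List (WeightedEdge (Fin N))} → Nonnegative L → ∀ i j → 0# ≤ totalWeight L i j
  totalWeight-nonneg []          i j = ≤-refl
  totalWeight-nonneg {L = (u , v , a) ∷ L} (0≤a ∷ 0≤L) i j =
    +-nonneg (+-nonneg (if-nonneg (does (u Fin.≟ i) ∧ does (v Fin.≟ j)) 0≤a) (if-nonneg (does (v Fin.≟ i) ∧ does (u Fin.≟ j)) 0≤a))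
             (totalWeight-nonneg 0≤L i j)

  weightMap : ∀ {N} (L : List (WeightedEdge (Fin N))) → Nonnegative L → WeightMap N
  weightMap L 0≤L = record
    { weight = λ ((i , j) , _) → totalWeight L i j
    ; nonneg = λ ((i , j) , _) → totalWeight-nonneg 0≤L i j
    }

  mask : ∀ {N} → (Fin N → Bool) → Fin N → Fin N → ℝ
  mask x i j = if does (i Fin.<? j) ∧ (x i xor x j) then 1# else 0#

  mask-matching : ∀ {N} (x : Fin N → Bool) u v a →
    sum (λ i → sum λ j → mask x i j * matching (u , v , a) i j) ≡ mask x u v * a
  mask-matching {N} x u v a = trans
    (sum-single u (λ i → sum λ j → mask x i j * matching (u , v , a) i j) λ i i≢u → sum-zero N λ j →
      trans (cong (λ b → mask x i j * (if b ∧ does (v Fin.≟ j) then a else 0#)) (dec-false (u Fin.≟ i) (i≢u ∘ sym))) (zeroʳ (mask x i j)))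
    (trans (sum-single v (λ j → mask x u j * matching (u , v , a) u j) λ j j≢v →
      trans (cong (λ b → mask x u j * (if b then a else 0#))
        (trans (cong (does (u Fin.≟ u) ∧_) (dec-false (v Fin.≟ j) (j≢v ∘ sym))) (Bool.∧-zeroʳ (does (u Fin.≟ u)))))
        (zeroʳ (mask x u j)))
    (cong (λ b → mask x u v * (if b then a else 0#)) (cong₂ _∧_ (dec-true (u Fin.≟ u) refl) (dec-true (v Fin.≟ v) refl))))

  -- Exactly one orientation of an edge is increasing, unless the edge is a loop, which crosses no
  -- cut.
  mask-crossing : ∀ {N} (x : Fin N → Bool) u v a → mask x u v * a + mask x v u * a ≡ crossing x (u , v , a)
  mask-crossing x u v a with Fin.<-cmp u v
  ... | tri< u<v _ ¬v<u rewrite dec-true (u Fin.<? v) u<v | dec-false (v Fin.<? u) ¬v<u = one-sided (x u xor x v)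
    where
    one-sided : ∀ b → (if b then 1# else 0#) * a + 0# * a ≡ (if b then a else 0#)
    one-sided true  = trans (cong₂ _+_ (*-identityˡ a) (zeroˡ a)) (+-identityʳ a)
    one-sided false = trans (cong₂ _+_ (zeroˡ a) (zeroˡ a)) (+-identityʳ 0#)
  ... | tri≈ ¬u<u refl _ rewrite dec-false (u Fin.<? u) ¬u<u | Bool.xor-same (x u) =
    trans (cong₂ _+_ (zeroˡ a) (zeroˡ a)) (+-identityʳ 0#)
  ... | tri> ¬u<v _ v<u rewrite dec-false (u Fin.<? v) ¬u<v | dec-true (v Fin.<? u) v<u | Bool.xor-comm (x v) (x u) = one-sided (x u xor x v)
    where
    one-sided : ∀ b → 0# * a + (if b then 1# else 0#) * a ≡ (if b then a else 0#)
    one-sided true  = trans (cong₂ _+_ (zeroˡ a) (*-identityˡ a)) (+-identityˡ a)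
    one-sided false = trans (cong₂ _+_ (zeroˡ a) (zeroˡ a)) (+-identityʳ 0#)

  doubleSum-+ : ∀ {N} (f g : Fin N → Fin N → ℝ) →
    sum (λ i → sum λ j → f i j + g i j) ≡ sum (λ i → sum (f i)) + sum (λ i → sum (g i))
  doubleSum-+ {N} f g = trans (sum-cong N λ i → ∑-distrib-+ (f i) (g i)) (∑-distrib-+ (λ i → sum (f i)) (λ i → sum (g i)))

  mask-totalWeight : ∀ {N} (L : List (WeightedEdge (Fin N))) x →
    sum (λ i → sum λ j → mask x i j * totalWeight L i j) ≡ cut L x
  mask-totalWeight {N} []      x = sum-zero N λ i → sum-zero N λ j → zeroʳ (mask x i j)
  mask-totalWeight {N} (e@(u , v , a) ∷ L) x = begin
    sum (λ i → sum λ j → m i j * ((matching e i j + matching e′ i j) + totalWeight L i j))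
      ≡⟨ sum-cong N (λ i → sum-cong N λ j → trans (distribˡ (m i j) _ _) (cong (_+ m i j * totalWeight L i j) (distribˡ (m i j) _ _))) ⟩
    sum (λ i → sum λ j → (m i j * matching e i j + m i j * matching e′ i j) + m i j * totalWeight L i j)
      ≡⟨ doubleSum-+ (λ i j → m i j * matching e i j + m i j * matching e′ i j) (λ i j → m i j * totalWeight L i j) ⟩
    sum (λ i → sum λ j → m i j * matching e i j + m i j * matching e′ i j) + sum (λ i → sum λ j → m i j * totalWeight L i j)
      ≡⟨ cong₂ _+_ (trans (doubleSum-+ (λ i j → m i j * matching e i j) (λ i j → m i j * matching e′ i j))
                     (trans (cong₂ _+_ (mask-matching x u v a) (mask-matching x v u a)) (mask-crossing x u v a)))
                   (mask-totalWeight L x) ⟩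
    crossing x e + cut L x ∎
    where
    open ≡-Reasoning
    m  = mask x
    e′ = v , u , a

  cutWeight-weightMap : ∀ {N} (L : List (WeightedEdge (Fin N))) (0≤L : Nonnegative L) W →
    cutWeight (weightMap L 0≤L) W ≡ cut L (lookup W)
  cutWeight-weightMap {N} L 0≤L W = trans (cutWeight-crossing (weightMap L 0≤L) W)
    (trans (sum-cong N λ i → sum-cong N λ j → term i j) (mask-totalWeight L (lookup W)))
    where
    term : ∀ i j → crossing (lookup W) (i , j , edgeWeight (weightMap L 0≤L) i j) ≡ mask (lookup W) i j * totalWeight L i j
    term i j with i Fin.<? j
    ... | yes i<j rewrite dec-true (i Fin.<? j) i<j = scale (lookup W i xor lookup W j)
      where
      scale : ∀ b → (if b then totalWeight L i j else 0#) ≡ (if b then 1# else 0#) * totalWeight L i j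
      scale true  = sym (*-identityˡ _)
      scale false = sym (zeroˡ _)
    ... | no i≮j rewrite dec-false (i Fin.<? j) i≮j = trans (if-0 (lookup W i xor lookup W j)) (sym (zeroˡ _))

  -- Realized vectors as minimum cuts of edge lists

  Attains : ∀ n k → List (WeightedEdge (Vertex n k)) → Vector n → Set
  Attains n k L S = ∀ I →
    (∃[ T ] S I ≡ cut L (vertexSide (value I) T)) ×
    (∀ T → S I ≤ cut L (vertexSide (value I) T))

  -- A `W` that meets the terminals in `I` is `I Vec.++ T` for a set `T` of further vertices, so
  -- both minima range over the same cuts.
  attains⇒H : ∀ {n k} (L : List (WeightedEdge (Vertex n k))) → Nonnegative L → ∀ {S} → Attains n k L S → H n S
  attains⇒H {n} {k} L 0≤L {S} attains = k , w , λ I →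
    (let T , S≡ = proj₁ (attains I) in
     value I Vec.++ T , take-++ (value I) T , trans S≡ (sym (weigh (value I) T))) ,
    (λ W take≡I → subst (S I ≤_)
      (trans (sym (weigh (value I) (drop n W))) (cong (cutWeight w ∘ embed) (++-drop W take≡I)))
      (proj₂ (attains I) (drop n W)))
    where
    w : WeightMap (suc (n ℕ.+ k))
    w = weightMap (relabel index L) (All.map⁺ 0≤L)
    weigh : ∀ I T → cutWeight w (embed (I Vec.++ T)) ≡ cut L (vertexSide I T)
    weigh I T = trans (cutWeight-weightMap (relabel index L) (All.map⁺ 0≤L) (embed (I Vec.++ T)))
      (trans (cut-relabel index L _) (cut-cong L (lookup-index I T)))

  H⇒attains : ∀ {n S} → H n S → ∃[ k ] Σ[ L ∈ List (WeightedEdge (Vertex n k)) ] Nonnegative L × Attains n k L S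
  H⇒attains {n} {S} (k , w , realizes) = k , relabel vertex (edges w) , All.map⁺ (edges-nonneg w) , λ I →
    (let W , take≡I , S≡ = proj₁ (realizes I) in
     drop n W , trans S≡ (trans (cong (cutWeight w ∘ embed) (sym (++-drop W take≡I))) (weigh (value I) (drop n W)))) ,
    (λ T → subst (S I ≤_) (weigh (value I) T) (proj₂ (realizes I) (value I Vec.++ T) (take-++ (value I) T)))
    where
    weigh : ∀ I T → cutWeight w (embed (I Vec.++ T)) ≡ cut (relabel vertex (edges w)) (vertexSide I T)
    weigh I T = trans (sym (cut-edges w (embed (I Vec.++ T))))
      (trans (cut-cong (edges w) (lookup-vertex I T)) (sym (cut-relabel vertex (edges w) (vertexSide I T))))

  minimizer : ∀ {k} (f : Subset k → ℝ) → ∃[ T ] (∀ T′ → f T ≤ f T′)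
  minimizer {zero}  f = [] , λ { [] → ≤-refl }
  minimizer {suc k} f with minimizer (λ T → f (outside ∷ T)) | minimizer (λ T → f (inside ∷ T))
  ... | T , min | U , min′ with ≤-total (f (outside ∷ T)) (f (inside ∷ U))
  ...   | inj₁ T≤U = outside ∷ T , λ { (outside ∷ V) → min V ; (inside ∷ V) → ≤-trans T≤U (min′ V) }
  ...   | inj₂ U≤T = inside ∷ U , λ { (outside ∷ V) → ≤-trans U≤T (min V) ; (inside ∷ V) → min′ V }

  -- The terminals of a network for `S` are moved along `ψ`, its further vertices are kept, and `S′`
  -- collects the minimum cuts. Where the sides in `J` pull back to those in `I`, the two networks
  -- have the same cuts for every choice of `T`.
  H-relabel : ∀ {n m} {S : Vector n} (ψ : Maybe (Fin n) → Maybe (Fin m)) → H n S →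
    Σ[ S′ ∈ Vector m ] H m S′ × (∀ J I → (∀ u → side (value J) (ψ u) ≡ side (value I) u) → S′ J ≡ S I)
  H-relabel {n} {m} {S} ψ HS with H⇒attains HS
  ... | k , L , 0≤L , attains = S′ , attains⇒H L′ (All.map⁺ 0≤L) attains′ , agree
    where
    φ : Vertex n k → Vertex m k
    φ (inj₁ u) = inj₁ (ψ u)
    φ (inj₂ v) = inj₂ v
    L′ = relabel φ L
    best : ∀ J → ∃[ T ] (∀ T′ → cut L′ (vertexSide J T) ≤ cut L′ (vertexSide J T′))
    best J = minimizer λ T → cut L′ (vertexSide J T)
    S′ : Vector m
    S′ J = cut L′ (vertexSide (value J) (proj₁ (best (value J))))
    attains′ : Attains m k L′ S′
    attains′ J = (proj₁ (best (value J)) , refl) , proj₂ (best (value J))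
    agree : ∀ J I → (∀ u → side (value J) (ψ u) ≡ side (value I) u) → S′ J ≡ S I
    agree J I sides = ≤-antisym
      (let T , S≡ = proj₁ (attains I) in subst (S′ J ≤_) (trans (same T) (sym S≡)) (proj₂ (best (value J)) T))
      (subst (S I ≤_) (sym (same (proj₁ (best (value J))))) (proj₂ (attains I) (proj₁ (best (value J)))))
      where
      same : ∀ T → cut L′ (vertexSide (value J) T) ≡ cut L (vertexSide (value I) T)
      same T = trans (cut-relabel φ L (vertexSide (value J) T)) (cut-cong L λ { (inj₁ u) → sides u ; (inj₂ v) → refl })

  H-0 : ∀ {n} → H n (λ _ → 0#)
  H-0 = attains⇒H {k = 0} [] [] λ I → ([] , refl) , λ T → ≤-refl

  -- Star networks

  ι : ℕ → ℝ
  ι zero    = 0#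
  ι (suc n) = 1# + ι n

  ι-+ : ∀ m n → ι (m ℕ.+ n) ≡ ι m + ι n
  ι-+ zero    n = sym (+-identityˡ _)
  ι-+ (suc m) n = trans (cong (1# +_) (ι-+ m n)) (sym (+-assoc 1# (ι m) (ι n)))

  ι-nonneg : ∀ n → 0# ≤ ι n
  ι-nonneg zero    = ≤-refl
  ι-nonneg (suc n) = +-nonneg 0≤1 (ι-nonneg n)

  ι-mono : ∀ {m n} → m ℕ.≤ n → ι m ≤ ι n
  ι-mono {n = n} z≤n = ι-nonneg n
  ι-mono (s≤s m≤n)   = +-monoʳ-≤ 1# (ι-mono m≤n)

  ι-if : ∀ b n → (if b then ι n else 0#) ≡ ι (if b then n else 0)
  ι-if true  n = refl
  ι-if false n = refl

  cut-spokes : ∀ {V A : Set} (v : V) (f : A → V) us (x : V → Bool) →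
    cut (List.map (λ u → v , f u , ι 1) us) x ≡ ι (count (λ u → x v xor x (f u)) us)
  cut-spokes v f []       x = refl
  cut-spokes v f (u ∷ us) x =
    trans (cong₂ _+_ (ι-if (x v xor x (f u)) 1) (cut-spokes v f us x))
      (sym (ι-+ (if x v xor x (f u) then 1 else 0) (count (λ u → x v xor x (f u)) us)))

  spokes-nonneg : ∀ {V A : Set} (v : V) (f : A → V) us → Nonnegative (List.map (λ u → v , f u , ι 1) us)
  spokes-nonneg v f us = All.map⁺ (All.universal (λ _ → ι-nonneg 1) us)

  ·-+ʳ : ∀ {n} (f g h : Subset n → ℝ) → f · (λ I → g I + h I) ≡ f · g + f · h
  ·-+ʳ {n} f g h = trans (sumSubsets-cong n λ I → distribˡ (f I) (g I) (h I)) (sumSubsets-+ (λ I → f I * g I) (λ I → f I * h I))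

  ·-congʳ : ∀ {n} (f : Subset n → ℝ) {g h : Subset n → ℝ} → (∀ I → f I ≢ 0# → g I ≡ h I) → f · g ≡ f · h
  ·-congʳ {n} f {g} {h} g≗h = sumSubsets-cong n term
    where
    term : ∀ I → f I * g I ≡ f I * h I
    term I with f I ≟ℝ 0#
    ... | yes fI≡0 rewrite fI≡0 = trans (zeroˡ (g I)) (sym (zeroˡ (h I)))
    ... | no fI≢0  = cong (f I *_) (g≗h I fI≢0)

  -- Without further vertices there is nothing to minimize, so the cut vector is a linear
  -- combination of vectors `separation u v`.
  pairBalanced⇒cut : ∀ {n} {q : Vector n} → PairBalanced q → ∀ L → ⟦ q ⟧ · (λ I → cut L (side I)) ≡ 0#
  pairBalanced⇒cut {n} {q} q-bal []                = sumSubsets-zero n λ I → zeroʳ (⟦ q ⟧ I)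
  pairBalanced⇒cut {n} {q} q-bal ((u , v , a) ∷ L) = begin
    ⟦ q ⟧ · (λ I → crossing (side I) (u , v , a) + cut L (side I))
      ≡⟨ ·-+ʳ ⟦ q ⟧ (λ I → crossing (side I) (u , v , a)) (λ I → cut L (side I)) ⟩
    ⟦ q ⟧ · (λ I → crossing (side I) (u , v , a)) + ⟦ q ⟧ · (λ I → cut L (side I))
      ≡⟨ cong₂ _+_ (sumSubsets-cong n λ I → scale (side I u xor side I v) (⟦ q ⟧ I)) (pairBalanced⇒cut {q = q} q-bal L) ⟩
    sumSubsets n (λ I → a * (⟦ q ⟧ I * separation u v I)) + 0#
      ≡⟨ +-identityʳ _ ⟩
    sumSubsets n (λ I → a * (⟦ q ⟧ I * separation u v I))
      ≡⟨ sumSubsets-*ˡ a (λ I → ⟦ q ⟧ I * separation u v I) ⟩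
    a * (⟦ q ⟧ · separation u v)
      ≡⟨ trans (cong (a *_) (q-bal u v)) (zeroʳ a) ⟩
    0# ∎
    where
    open ≡-Reasoning
    scale : ∀ b x → x * (if b then a else 0#) ≡ a * (x * (if b then 1# else 0#))
    scale true  x = trans (*-comm x a) (cong (a *_) (sym (*-identityʳ x)))
    scale false x = trans (zeroʳ x) (sym (trans (cong (a *_) (zeroʳ x)) (zeroʳ a)))

  -- The network whose minimum cuts are given by `starCut`: its only further vertex is the hub, and
  -- `us` lists the light spokes. `t` may be the sink and `us` may contain `s`; parallel spokes then
  -- add up.
  module Star {n} (s : Fin n) (t : Maybe (Fin n)) (us : List (Fin n)) where
    h : ℕ
    h = length us

    hub : Vertex n 1
    hub = inj₂ zero

    starEdges : ℕ → List (WeightedEdge (Vertex n 1))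
    starEdges a = (hub , inj₁ (just s) , ι (suc (2 ℕ.* h) ℕ.+ a)) ∷ (hub , inj₁ t , ι (suc (2 ℕ.* h))) ∷
      (hub , inj₁ nothing , ι (suc h)) ∷ List.map (λ u → hub , inj₁ (just u) , ι 1) us

    ins outs : Subset n → ℕ
    ins I  = count (lookup I) us
    outs I = count (not ∘ lookup I) us

    minCut : ℕ → Subset n → ℕ
    minCut a I = starCut h a (lookup I s) (side I t) (ins I) (outs I)

    S : ℕ → Vector n
    S a I = ι (minCut a (value I))

    sum-ι : ∀ {x₁ x₂ x₃ x₄} m₁ m₂ m₃ m₄ → x₁ ≡ ι m₁ → x₂ ≡ ι m₂ → x₃ ≡ ι m₃ → x₄ ≡ ι m₄ →
      x₁ + (x₂ + (x₃ + x₄)) ≡ ι (m₁ ℕ.+ (m₂ ℕ.+ (m₃ ℕ.+ m₄)))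
    sum-ι m₁ m₂ m₃ m₄ refl refl refl refl =
      sym (trans (ι-+ m₁ _) (cong (ι m₁ +_) (trans (ι-+ m₂ _) (cong (ι m₂ +_) (ι-+ m₃ m₄)))))

    cut-star-outside : ∀ a I → cut (starEdges a) (vertexSide I (outside ∷ [])) ≡ ι (hubOutside h a (lookup I s) (side I t) (ins I))
    cut-star-outside a I = sum-ι (if lookup I s then suc (2 ℕ.* h) ℕ.+ a else 0) (if side I t then suc (2 ℕ.* h) else 0) 0 (ins I)
      (ι-if (lookup I s) (suc (2 ℕ.* h) ℕ.+ a)) (ι-if (side I t) (suc (2 ℕ.* h))) refl
      (cut-spokes hub (inj₁ ∘ just) us (vertexSide I (outside ∷ [])))

    cut-star-inside : ∀ a I → cut (starEdges a) (vertexSide I (inside ∷ [])) ≡ ι (hubInside h a (lookup I s) (side I t) (outs I))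
    cut-star-inside a I = sum-ι (if not (lookup I s) then suc (2 ℕ.* h) ℕ.+ a else 0) (if not (side I t) then suc (2 ℕ.* h) else 0) (suc h) (outs I)
      (ι-if (not (lookup I s)) (suc (2 ℕ.* h) ℕ.+ a)) (ι-if (not (side I t)) (suc (2 ℕ.* h))) refl
      (cut-spokes hub (inj₁ ∘ just) us (vertexSide I (inside ∷ [])))

    S∈H : ∀ a → H n (S a)
    S∈H a = attains⇒H (starEdges a)
      (ι-nonneg (suc (2 ℕ.* h) ℕ.+ a) ∷ ι-nonneg (suc (2 ℕ.* h)) ∷ ι-nonneg (suc h) ∷ spokes-nonneg hub (inj₁ ∘ just) us)
      λ I → attained (value I) , below (value I)
      where
      attained : ∀ I → ∃[ T ] ι (minCut a I) ≡ cut (starEdges a) (vertexSide I T)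
      attained I with ℕ.⊓-sel (hubOutside h a (lookup I s) (side I t) (ins I)) (hubInside h a (lookup I s) (side I t) (outs I))
      ... | inj₁ eq = (outside ∷ []) , trans (cong ι eq) (sym (cut-star-outside a I))
      ... | inj₂ eq = (inside ∷ []) , trans (cong ι eq) (sym (cut-star-inside a I))
      below : ∀ I T → ι (minCut a I) ≤ cut (starEdges a) (vertexSide I T)
      below I (outside ∷ []) = subst (ι (minCut a I) ≤_) (sym (cut-star-outside a I))
        (ι-mono (ℕ.m⊓n≤m (hubOutside h a (lookup I s) (side I t) (ins I)) (hubInside h a (lookup I s) (side I t) (outs I))))
      below I (inside ∷ [])  = subst (ι (minCut a I) ≤_) (sym (cut-star-inside a I))
        (ι-mono (ℕ.m⊓n≤n (hubOutside h a (lookup I s) (side I t) (ins I)) (hubInside h a (lookup I s) (side I t) (outs I))))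

    -- Annihilating the stars for `a = 0, 1, 2`, `r` annihilates their second difference. At the
    -- empty set the tie is 0 because `s` is outside.
    second-difference : ∀ (r : Subset n → ℝ) → (∀ a → r · ⟦ S a ⟧ ≡ 0#) →
      r · (λ I → ι (tie (lookup I s) (side I t) (outs I))) ≡ 0#
    second-difference r r·S≡0 = begin
      r · e
        ≡⟨ +-identityˡ _ ⟨
      0# + r · e
        ≡⟨ cong (_+ r · e) (trans (cong₂ _+_ (r·S≡0 0) (r·S≡0 2)) (+-identityˡ 0#)) ⟨
      r · ⟦ S 0 ⟧ + r · ⟦ S 2 ⟧ + r · e
        ≡⟨ cong (_+ r · e) (·-+ʳ r ⟦ S 0 ⟧ ⟦ S 2 ⟧) ⟨
      r · (λ I → ⟦ S 0 ⟧ I + ⟦ S 2 ⟧ I) + r · e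
        ≡⟨ ·-+ʳ r (λ I → ⟦ S 0 ⟧ I + ⟦ S 2 ⟧ I) e ⟨
      r · (λ I → ⟦ S 0 ⟧ I + ⟦ S 2 ⟧ I + e I)
        ≡⟨ ·-congʳ r (λ I _ → pointwise I) ⟩
      r · (λ I → ⟦ S 1 ⟧ I + ⟦ S 1 ⟧ I)
        ≡⟨ ·-+ʳ r ⟦ S 1 ⟧ ⟦ S 1 ⟧ ⟩
      r · ⟦ S 1 ⟧ + r · ⟦ S 1 ⟧
        ≡⟨ trans (cong₂ _+_ (r·S≡0 1) (r·S≡0 1)) (+-identityˡ 0#) ⟩
      0# ∎
      where
      open ≡-Reasoning
      e : Subset n → ℝ
      e I = ι (tie (lookup I s) (side I t) (outs I))
      pointwise : ∀ I → ⟦ S 0 ⟧ I + ⟦ S 2 ⟧ I + e I ≡ ⟦ S 1 ⟧ I + ⟦ S 1 ⟧ I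
      pointwise I with nonempty? I
      ... | no I≡∅ = trans (cong (0# + 0# +_) (cong (λ σ → ι (tie σ (side I t) (outs I))) (∅-outside I≡∅ (just s)))) (+-identityʳ (0# + 0#))
      ... | yes _ = begin
        ι (minCut 0 I) + ι (minCut 2 I) + e I
          ≡⟨ cong (_+ e I) (ι-+ (minCut 0 I) (minCut 2 I)) ⟨
        ι (minCut 0 I ℕ.+ minCut 2 I) + e I
          ≡⟨ ι-+ (minCut 0 I ℕ.+ minCut 2 I) (tie (lookup I s) (side I t) (outs I)) ⟨
        ι (minCut 0 I ℕ.+ minCut 2 I ℕ.+ tie (lookup I s) (side I t) (outs I))
          ≡⟨ cong ι (starCut-second-difference (ins I) (outs I) (count-complement (lookup I) us) (lookup I s) (side I t)) ⟩
        ι (minCut 1 I ℕ.+ minCut 1 I)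
          ≡⟨ ι-+ (minCut 1 I) (minCut 1 I) ⟩
        ι (minCut 1 I) + ι (minCut 1 I) ∎

    -- If s and t lie on the same side of I then so does the hub, and contracting it
    -- into s leaves a network without further vertices.
    S-facial : ∀ (q : Vector n) → PairBalanced q → (∀ I → ⟦ q ⟧ I ≢ 0# → lookup I s ≡ side I t) → ∀ a → q ∙ S a ≡ 0#
    S-facial q q-bal same a = trans (∙-· q (S a)) (trans (·-congʳ ⟦ q ⟧ contracted-cut) (pairBalanced⇒cut {q = q} q-bal contracted))
      where
      contracted : List (WeightedEdge (Maybe (Fin n)))
      -- The heavy spoke at `s` would be a loop and the one at `t` would join vertices on the same
      -- side, so neither is listed.
      contracted = (just s , nothing , ι (suc h)) ∷ List.map (λ u → just s , just u , ι 1) us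
      contracted-cut : ∀ I → ⟦ q ⟧ I ≢ 0# → ⟦ S a ⟧ I ≡ cut contracted (side I)
      contracted-cut I qI≢0 = trans (⟦⟧-value (S a) (I , [ ⟦⟧-nonempty q qI≢0 ])) (trans (by-side (same I qI≢0)) (sym total))
        where
        total : cut contracted (side I) ≡ ι ((if lookup I s xor false then suc h else 0) ℕ.+ count (λ u → lookup I s xor lookup I u) us)
        total = trans (cong₂ _+_ (ι-if (lookup I s xor false) (suc h)) (cut-spokes (just s) just us (side I)))
          (sym (ι-+ (if lookup I s xor false then suc h else 0) _))
        by-side : lookup I s ≡ side I t → ι (minCut a I) ≡ ι ((if lookup I s xor false then suc h else 0) ℕ.+ count (λ u → lookup I s xor lookup I u) us)
        by-side eq with lookup I s | side I t
        by-side refl | true  | true  = cong ι (starCut-inside {c = ins I} (count-complement (lookup I) us) a)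
        by-side refl | false | false = cong ι (starCut-outside {c̄ = outs I} (count-complement (lookup I) us) a)

  -- With the elements of `J` on the light spokes, the second difference is supported on the `I`
  -- that contain `J` and `s` but not `t`. Proper supersets of `J` contribute 0 by induction, which
  -- isolates `r J`.
  face-annihilator-vanishes : ∀ {n} (q : Vector n) → PairBalanced q →
    ∀ (s : Fin n) t → (∀ I → ⟦ q ⟧ I ≢ 0# → lookup I s ≡ side I t) →
    ∀ (r : Subset n → ℝ) → (∀ S → H n S × q ∙ S ≡ 0# → r · ⟦ S ⟧ ≡ 0#) →
    ∀ J → lookup J s ≡ true → side J t ≡ false → r J ≡ 0#
  face-annihilator-vanishes {n} q q-bal s t same r r⊥ J = by-induction J (⊃-wellFounded J)
    where
    by-induction : ∀ J → Acc _ J → lookup J s ≡ true → side J t ≡ false → r J ≡ 0#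
    by-induction J (acc rec) s∈J t∉J = begin
      r J
        ≡⟨ trans (cong (r J *_) tied) (trans (cong (r J *_) (+-identityʳ 1#)) (*-identityʳ (r J))) ⟨
      r J * ι (tie (lookup J s) (side J t) (outs J))
        ≡⟨ sumSubsets-single J others ⟨
      r · (λ I → ι (tie (lookup I s) (side I t) (outs I)))
        ≡⟨ second-difference r (λ a → r⊥ (S a) (S∈H a , S-facial q q-bal same a)) ⟩
      0# ∎
      where
      open ≡-Reasoning
      open Star s t (elements J)
      tied : ι (tie (lookup J s) (side J t) (outs J)) ≡ ι 1
      tied = cong ι (trans (cong₂ (λ σ τ → tie σ τ (outs J)) s∈J t∉J) (cong (tie true false)
        (all⇒count-not≡0 (lookup J) (All.tabulate λ u∈ → Vec.[]=⇒lookup (proj₂ (∈-filter⁻ (_∈? J) {xs = allFin n} u∈))))))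
      larger : ∀ I → I ≢ J → lookup I s ≡ true → side I t ≡ false → outs I ≡ 0 → r I ≡ 0#
      larger I I≢J s∈I t∉I outs≡0 = by-induction I (rec (J⊆I , decidable-stable (excluded-middle _) λ ¬x →
          I≢J (⊆-antisym (λ {x} x∈I → decidable-stable (x ∈? J) λ x∉J → ¬x (x , x∈I , x∉J)) J⊆I))) s∈I t∉I
        where
        J⊆I : J ⊆ I
        J⊆I {x} x∈J = Vec.lookup⇒[]= x I (All.lookup (count-not≡0 (lookup I) (elements J) outs≡0) (∈-filter⁺ (_∈? J) (∈-allFin x) x∈J))
      others : ∀ I → I ≢ J → r I * ι (tie (lookup I s) (side I t) (outs I)) ≡ 0#
      others I I≢J with lookup I s in s∈I | side I t in t∉I | outs I in outs≡
      ... | true  | false | zero  = trans (cong (_* ι 1) (larger I I≢J s∈I t∉I outs≡)) (zeroˡ (ι 1))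
      ... | true  | false | suc _ = zeroʳ (r I)
      ... | true  | true  | _     = zeroʳ (r I)
      ... | false | _     | _     = zeroʳ (r I)

  -- Facets

  Face : ∀ {n} → Vector n → Vector n → Set
  Face {n} q S = H n S × q ∙ S ≡ 0#

  Annihilates : ∀ {n} → (Subset n → ℝ) → (Vector n → Set) → Set
  Annihilates r P = ∀ S → P S → r · ⟦ S ⟧ ≡ 0#

  Multiple : ∀ {n} → (Subset n → ℝ) → Vector n → Set
  Multiple r q = ∃[ l ] (∀ I → r I ≡ l * ⟦ q ⟧ I)

  ·-*ʳ : ∀ {n} (f : Subset n → ℝ) x g → f · (λ I → x * g I) ≡ x * (f · g)
  ·-*ʳ {n} f x g = trans (sumSubsets-cong n λ I → x∙yz≈y∙xz (f I) x (g I)) (sumSubsets-*ˡ x λ I → f I * g I)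

  0∈Face : ∀ {n} (q : Vector n) → Face q (λ _ → 0#)
  0∈Face {n} q = H-0 , trans (∙-· q (λ _ → 0#)) (sumSubsets-zero n λ I → trans (cong (⟦ q ⟧ I *_) (zero-vector I)) (zeroʳ (⟦ q ⟧ I)))
    where
    zero-vector : ∀ I → ⟦ (λ _ → 0#) ⟧ I ≡ 0#
    zero-vector I with nonempty? I
    ... | yes _ = refl
    ... | no  _ = refl

  -- The origin lies on every face, so it joins `k` linearly independent vectors as a further point.
  affineFamily : ∀ {n e} (D : Fin e → Subset n) (q : Vector n) →
    (∀ r → Annihilates r (Face q) → (∀ i → r (D i) ≡ 0#) → ∀ I → r I ≡ 0#) →
    ∀ k → k ℕ.+ e ℕ.≤ 2 ℕ.^ n → ∃[ p ] (∀ i → Face q (p i)) × AffinelyIndependent {n} {suc k} p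
  affineFamily D q spans k k+e≤ =
    let p , Pp , p-ind = independent-family D (Face q) spans k k+e≤
    in (λ _ → 0#) ∷ᶠ p , (λ { zero → 0∈Face q ; (suc i) → Pp i }) , affinelyIndependent-0∷ ((λ _ → 0#) ∷ᶠ p) (λ _ → refl) p-ind

  -- If `q` were 0, its face would be the whole cone. Stars with `t` the sink make every annihilator
  -- vanish on nonempty sets, so the face would contain more affinely independent points than a
  -- facet has.
  facet-nonzero : ∀ {n} .{{_ : NonZero n}} (q : Vector n) → PairBalanced q → IsFacet q → ∃[ I ] ⟦ q ⟧ I ≢ 0#
  facet-nonzero {n} q q-bal (_ , _ , no-larger) = decidable-stable (excluded-middle _) λ q≡0 →
    -- `⊥` is listed because no vector has a coordinate there, so annihilation does not constrain
    -- `r ⊥`.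
    let p , Pp , p-ind = affineFamily {e = 1} (λ _ → ⊥) q (spans q≡0) (suc (2 ℕ.^ n ℕ.∸ 2))
          (ℕ.≤-reflexive (trans (ℕ.+-comm _ 1) (2+[2^n∸2] n)))
    in no-larger p Pp p-ind
    where
    spans : ¬ (∃[ I ] ⟦ q ⟧ I ≢ 0#) → ∀ r → Annihilates r (Face q) → (Fin 1 → r ⊥ ≡ 0#) → ∀ I → r I ≡ 0#
    spans q≡0 r r⊥ r∅ I with nonempty? I
    ... | yes (s , s∈I) = face-annihilator-vanishes q q-bal s nothing (λ I qI≢0 → contradiction (I , qI≢0) q≡0) r r⊥ I (Vec.[]=⇒lookup s∈I) refl
    ... | no I≡∅ rewrite Empty-unique I≡∅ = r∅ zero

  -- `l` is chosen so that `r - l q` vanishes at `I₀`. If it did not vanish at some `I₁`, then it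
  -- and `q` would be two independent equations for the face, leaving too little room for the
  -- affinely independent points of a facet.
  face-annihilator-multiple : ∀ {n} .{{_ : NonZero n}} (q : Vector n) → IsFacet q → ∃[ I ] ⟦ q ⟧ I ≢ 0# →
    ∀ r → Grounded r → Annihilates r (Face q) → Multiple r q
  face-annihilator-multiple {n} q (_ , (p , Pp , p-ind) , _) (I₀ , qI₀≢0) r r∅ r⊥ = l , λ I →
    decidable-stable (r I ≟ℝ l * ⟦ q ⟧ I) λ rI≢ → too-many I λ r′I≡0 → rI≢ (difference I r′I≡0)
    where
    open ≡-Reasoning
    inverse = *-inverse (⟦ q ⟧ I₀) qI₀≢0
    l = r I₀ * proj₁ inverse
    r′ : Subset n → ℝ
    r′ I = r I + (- l) * ⟦ q ⟧ I
    l*q : l * ⟦ q ⟧ I₀ ≡ r I₀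
    l*q = trans (*-assoc (r I₀) (proj₁ inverse) (⟦ q ⟧ I₀)) (trans
      (cong (r I₀ *_) (trans (*-comm (proj₁ inverse) (⟦ q ⟧ I₀)) (proj₂ inverse))) (*-identityʳ (r I₀)))
    r′I₀ : r′ I₀ ≡ 0#
    r′I₀ = trans (cong (r I₀ +_) (trans (sym (-‿distribˡ-* l (⟦ q ⟧ I₀))) (cong -_ l*q))) (-‿inverseʳ (r I₀))
    difference : ∀ I → r′ I ≡ 0# → r I ≡ l * ⟦ q ⟧ I
    difference I r′I≡0 = begin
      r I                                         ≡⟨ +-identityʳ (r I) ⟨
      r I + 0#                                    ≡⟨ cong (r I +_) (-‿inverseˡ (l * ⟦ q ⟧ I)) ⟨
      r I + (- (l * ⟦ q ⟧ I) + l * ⟦ q ⟧ I)       ≡⟨ +-assoc (r I) (- (l * ⟦ q ⟧ I)) (l * ⟦ q ⟧ I) ⟨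
      r I + - (l * ⟦ q ⟧ I) + l * ⟦ q ⟧ I         ≡⟨ cong (λ x → r I + x + l * ⟦ q ⟧ I) (-‿distribˡ-* l (⟦ q ⟧ I)) ⟩
      r′ I + l * ⟦ q ⟧ I                          ≡⟨ cong (_+ l * ⟦ q ⟧ I) r′I≡0 ⟩
      0# + l * ⟦ q ⟧ I                            ≡⟨ +-identityˡ (l * ⟦ q ⟧ I) ⟩
      l * ⟦ q ⟧ I                                 ∎
    q·p : ∀ i → ⟦ q ⟧ · ⟦ p i ⟧ ≡ 0#
    q·p i = trans (sym (∙-· q (p i))) (proj₂ (Pp i))
    r′·p : ∀ i → r′ · ⟦ p i ⟧ ≡ 0#
    r′·p i = begin
      r′ · ⟦ p i ⟧
        ≡⟨ ·-comm r′ ⟦ p i ⟧ ⟩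
      ⟦ p i ⟧ · r′
        ≡⟨ ·-+ʳ ⟦ p i ⟧ r (λ I → (- l) * ⟦ q ⟧ I) ⟩
      ⟦ p i ⟧ · r + ⟦ p i ⟧ · (λ I → (- l) * ⟦ q ⟧ I)
        ≡⟨ cong₂ _+_ (trans (·-comm ⟦ p i ⟧ r) (r⊥ (p i) (Pp i))) (·-*ʳ ⟦ p i ⟧ (- l) ⟦ q ⟧) ⟩
      0# + (- l) * (⟦ p i ⟧ · ⟦ q ⟧)
        ≡⟨ +-identityˡ _ ⟩
      (- l) * (⟦ p i ⟧ · ⟦ q ⟧)
        ≡⟨ trans (cong ((- l) *_) (trans (·-comm ⟦ p i ⟧ ⟦ q ⟧) (q·p i))) (zeroʳ (- l)) ⟩
      0# ∎
    too-many : ∀ I₁ → ¬ (r′ I₁ ≢ 0#)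
    too-many I₁ r′I₁≢0 = ℕ.1+n≰n (subst (λ k → suc k ℕ.≤ 2 ℕ.^ n) (2+[2^n∸2] n)
      (affinelyIndependent-bound p p-ind D D≢∅ D-injective determined))
      where
      I₁≢I₀ : I₁ ≢ I₀
      I₁≢I₀ refl = r′I₁≢0 r′I₀
      D : Fin 2 → Subset n
      D zero       = I₀
      D (suc zero) = I₁
      D≢∅ : ∀ j → Nonempty (D j)
      D≢∅ zero       = ⟦⟧-nonempty q qI₀≢0
      D≢∅ (suc zero) = decidable-stable (nonempty? I₁) λ I₁≡∅ → r′I₁≢0
        (trans (cong₂ _+_ (r∅ I₁ I₁≡∅) (trans (cong ((- l) *_) (⟦⟧-grounded q I₁ I₁≡∅)) (zeroʳ (- l)))) (+-identityˡ 0#))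
      D-injective : ∀ i j → D i ≡ D j → i ≡ j
      D-injective zero       zero       _  = refl
      D-injective zero       (suc zero) eq = contradiction (sym eq) I₁≢I₀
      D-injective (suc zero) zero       eq = contradiction eq I₁≢I₀
      D-injective (suc zero) (suc zero) _  = refl
      determined : ∀ a → (∀ I → (∀ j → D j ≢ I) → sum (λ i → a i * ⟦ p i ⟧ I) ≡ 0#) →
        ∀ j → sum (λ i → a i * ⟦ p i ⟧ (D j)) ≡ 0#
      determined a off-D = λ { zero → x₀ ; (suc zero) → x₁ }
        where
        x : Subset n → ℝ
        x I = sum (λ i → a i * ⟦ p i ⟧ I)
        off : ∀ I → I ≢ I₀ → I ≢ I₁ → x I ≡ 0#
        off I I≢I₀ I≢I₁ = off-D I λ { zero eq → I≢I₀ (sym eq) ; (suc zero) eq → I≢I₁ (sym eq) }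
        -- The two equations are triangular: `r′` vanishes at `I₀` and yields the coordinate at
        -- `I₁`, after which `q` yields the one at `I₀`.
        x₁ : x I₁ ≡ 0#
        x₁ = *-cancel-0 r′I₁≢0 (trans (sym (sumSubsets-single I₁ term)) (·-combination-zero r′ a (λ i → ⟦ p i ⟧) r′·p))
          where
          term : ∀ I → I ≢ I₁ → r′ I * x I ≡ 0#
          term I I≢I₁ with I ≟ˢ I₀
          ... | yes refl = trans (cong (_* x I) r′I₀) (zeroˡ (x I))
          ... | no I≢I₀  = trans (cong (r′ I *_) (off I I≢I₀ I≢I₁)) (zeroʳ (r′ I))
        x₀ : x I₀ ≡ 0#
        x₀ = *-cancel-0 qI₀≢0 (trans (sym (sumSubsets-single I₀ term)) (·-combination-zero ⟦ q ⟧ a (λ i → ⟦ p i ⟧) q·p))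
          where
          term : ∀ I → I ≢ I₀ → ⟦ q ⟧ I * x I ≡ 0#
          term I I≢I₀ with I ≟ˢ I₁
          ... | yes refl = trans (cong (⟦ q ⟧ I *_) x₁) (zeroʳ (⟦ q ⟧ I))
          ... | no I≢I₁  = trans (cong (⟦ q ⟧ I *_) (off I I≢I₀ I≢I₁)) (zeroʳ (⟦ q ⟧ I))

  -- On the hyperplane the coordinate at `I₀` is determined by the others.
  hyperplane-bound : ∀ {n} .{{_ : NonZero n}} (q : Vector n) → ∃[ I ] ⟦ q ⟧ I ≢ 0# →
    (p : Fin (suc (suc (2 ℕ.^ n ℕ.∸ 2))) → Vector n) → (∀ i → q ∙ p i ≡ 0#) → ¬ AffinelyIndependent p
  hyperplane-bound {n} q (I₀ , qI₀≢0) p q∙p p-ind = ℕ.1+n≰n (subst (λ k → suc k ℕ.≤ 2 ℕ.^ n) (2+[2^n∸2] n)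
    (affinelyIndependent-bound {e = 1} p p-ind (λ _ → I₀) (λ _ → ⟦⟧-nonempty q qI₀≢0) (λ { zero zero _ → refl })
      λ a off _ → *-cancel-0 qI₀≢0 (trans
        (sym (sumSubsets-single I₀ λ I I≢I₀ → trans (cong (⟦ q ⟧ I *_) (off I λ _ → I≢I₀ ∘ sym)) (zeroʳ (⟦ q ⟧ I))))
        (·-combination-zero ⟦ q ⟧ a (λ i → ⟦ p i ⟧) λ i → trans (sym (∙-· q (p i))) (q∙p i)))))

  -- A multiple of `q` that vanishes at `I₀` is 0. So the face lacks only the coordinates `⊥` and
  -- `I₀` for spanning, and it contains `2 ℕ.^ n ℕ.∸ 2` independent vectors.
  facet-criterion : ∀ {n} .{{_ : NonZero n}} (q : Vector n) → ∃[ I ] ⟦ q ⟧ I ≢ 0# → (∀ S → H n S → 0# ≤ q ∙ S) →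
    (∀ r → Grounded r → Annihilates r (Face q) → Multiple r q) → IsFacet q
  facet-criterion {n} q nonzero@(I₀ , qI₀≢0) valid multiple =
    valid ,
    affineFamily D q spans (2 ℕ.^ n ℕ.∸ 2) (ℕ.≤-reflexive (trans (ℕ.+-comm _ 2) (2+[2^n∸2] n))) ,
    λ p Pp → hyperplane-bound q nonzero p (proj₂ ∘ Pp)
    where
    D : Fin 2 → Subset n
    D zero       = ⊥
    D (suc zero) = I₀
    spans : ∀ r → Annihilates r (Face q) → (∀ i → r (D i) ≡ 0#) → ∀ I → r I ≡ 0#
    spans r r⊥ rD I =
      let l , r≡lq = multiple r (λ I I≡∅ → trans (cong r (Empty-unique I≡∅)) (rD zero)) r⊥
          l≡0 = *-cancel-0 qI₀≢0 (trans (*-comm _ l) (trans (sym (r≡lq I₀)) (rD (suc zero))))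
      in trans (r≡lq I) (trans (cong (_* ⟦ q ⟧ I) l≡0) (zeroˡ (⟦ q ⟧ I)))

  -- Zero-lifts of facets

  δ-grounded : ∀ {n} (J : Subset n) → Nonempty J → Grounded (δ J)
  δ-grounded J J≢∅ I I≡∅ = δ-distinct {J = J} {I} λ { refl → I≡∅ J≢∅ }

  -- It serves both for contracting networks on the larger terminal set and for placing networks for
  -- `q` on representatives.
  H-pull : ∀ {m n} (φ : Maybe (Fin n) → Maybe (Fin m)) → φ nothing ≡ nothing → ∀ {S} → H n S →
    Σ[ S′ ∈ Vector m ] H m S′ × (∀ J → Nonempty (pull φ J) → ⟦ S′ ⟧ J ≡ ⟦ S ⟧ (pull φ J))
  H-pull {m} {n} φ φ∞ {S} HS =
    let S′ , HS′ , agree = H-relabel φ HS in S′ , HS′ , λ J pullJ≢∅ →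
    let J≢∅ = pull-nonempty φ J pullJ≢∅ in begin
      ⟦ S′ ⟧ J            ≡⟨ ⟦⟧-value S′ (J , [ J≢∅ ]) ⟩
      S′ (J , [ J≢∅ ])    ≡⟨ agree (J , [ J≢∅ ]) (pull φ J , [ pullJ≢∅ ]) (λ u → sym (side-pull φ φ∞ J u)) ⟩
      S (pull φ J , [ pullJ≢∅ ]) ≡⟨ ⟦⟧-value S (pull φ J , [ pullJ≢∅ ]) ⟨
      ⟦ S ⟧ (pull φ J)    ∎
    where open ≡-Reasoning

  -- φ contracts each F i to i, and every terminal outside all of them to the
  -- sink; ψ picks a representative of each F i.
  module Lift {n} .{{_ : NonZero n}} (q : Vector n) (q-bal : PairBalanced q) (q-facet : IsFacet q)
              (F : Fin n → Subset (suc n)) (F-family : LiftFamily q F) where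

    q⁺ : Vector (suc n)
    q⁺ = zeroLift F q

    φ : Maybe (Fin (suc n)) → Maybe (Fin n)
    φ nothing  = nothing
    φ (just j) with excluded-middle (∃[ i ] Appears q i × j ∈ F i)
    ... | yes (i , _) = just i
    ... | no _        = nothing

    ψ : Maybe (Fin n) → Maybe (Fin (suc n))
    ψ nothing  = nothing
    ψ (just i) with excluded-middle (Appears q i)
    ... | yes i∈K = just (proj₁ (proj₁ F-family i i∈K))
    -- A terminal that does not appear in `q` lies in no set of the support, so it may be merged
    -- with the sink.
    ... | no _    = nothing

    φ-just : ∀ {i j} → Appears q i → j ∈ F i → φ (just j) ≡ just i
    φ-just {i} {j} i∈K j∈Fi with excluded-middle (∃[ i ] Appears q i × j ∈ F i)
    ... | no ¬i = contradiction (i , i∈K , j∈Fi) ¬i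
    ... | yes (i′ , i′∈K , j∈Fi′) = cong just (decidable-stable (i′ Fin.≟ i) λ i′≢i →
      proj₂ F-family i′ i i′∈K i∈K i′≢i (j , x∈p∩q⁺ (j∈Fi′ , j∈Fi)))

    φ-just⁻ : ∀ j {i} → φ (just j) ≡ just i → Appears q i × j ∈ F i
    φ-just⁻ j eq with excluded-middle (∃[ i ] Appears q i × j ∈ F i)
    φ-just⁻ j refl | yes (_ , i∈K , j∈Fi) = i∈K , j∈Fi
    φ-just⁻ j ()   | no _

    φψ : ∀ {i} → Appears q i → φ (ψ (just i)) ≡ just i
    φψ {i} i∈K with excluded-middle (Appears q i)
    ... | yes i∈K′ = φ-just i∈K′ (proj₂ (proj₁ F-family i i∈K′))
    ... | no i∉K   = contradiction i∈K i∉K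

    -- Besides the sink, `φ` takes only values that appear in `q`, and these have representatives.
    φψφ : ∀ u → φ (ψ (φ u)) ≡ φ u
    φψφ nothing  = refl
    φψφ (just j) with φ (just j) in eq
    ... | nothing = refl
    ... | just i  = φψ (proj₁ (φ-just⁻ j eq))

    support : ∀ {I} → ⟦ q ⟧ I ≢ 0# → ∀ i → lookup I i ≡ true → Appears q i
    support {I} qI≢0 i Ii = (I , [ i , i∈I ]) , i∈I , λ qI≡0 → qI≢0 (trans (⟦⟧-value q (I , [ i , i∈I ])) qI≡0)
      where i∈I = Vec.lookup⇒[]= i I Ii

    -- All elements of a set in the support appear in `q`, so the constraints on `F` apply to each
    -- set in the union.
    unionOver-pull : ∀ {I} → ⟦ q ⟧ I ≢ 0# → unionOver F I ≡ pull φ I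
    unionOver-pull {I} qI≢0 = side-injective λ j → trans (true-iff (forth j) (back j)) (sym (side-pull φ refl I (just j)))
      where
      forth : ∀ j → lookup (unionOver F I) j ≡ true → side I (φ (just j)) ≡ true
      forth j eq = let i , i∈I , j∈Fi = ∈-unionOver⁻ F I (Vec.lookup⇒[]= j _ eq); Ii = Vec.[]=⇒lookup i∈I in
        trans (cong (side I) (φ-just (support qI≢0 i Ii) j∈Fi)) Ii
      back : ∀ j → side I (φ (just j)) ≡ true → lookup (unionOver F I) j ≡ true
      back j eq = let i , φj , Ii = ∈-side (φ (just j)) eq in
        Vec.[]=⇒lookup (∈-unionOver⁺ F I (Vec.lookup⇒[]= i I Ii) (proj₂ (φ-just⁻ j φj)))

    pull-retract : ∀ {I} → ⟦ q ⟧ I ≢ 0# → pull ψ (pull φ I) ≡ I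
    pull-retract {I} qI≢0 = side-injective λ i → trans (side-pull ψ refl (pull φ I) (just i)) (trans (side-pull φ refl I (ψ (just i))) (retracted i))
      where
      retracted : ∀ i → side I (φ (ψ (just i))) ≡ lookup I i
      retracted i with excluded-middle (Appears q i)
      ... | yes i∈K = cong (side I) (φ-just i∈K (proj₂ (proj₁ F-family i i∈K)))
      ... | no i∉K  = sym (Bool.¬-not λ Ii → i∉K (support qI≢0 i Ii))

    pull-φ-nonempty : ∀ {I} → ⟦ q ⟧ I ≢ 0# → Nonempty (pull φ I)
    pull-φ-nonempty {I} qI≢0 = pull-nonempty ψ (pull φ I) (subst Nonempty (sym (pull-retract qI≢0)) (⟦⟧-nonempty q qI≢0))

    q⁺-· : ∀ {g} → Grounded g → ⟦ q⁺ ⟧ · g ≡ ⟦ q ⟧ · (g ∘ pull φ)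
    q⁺-· {g} g∅ = trans (substituteTerms-· (unionOver F) q g∅) (·-congʳ ⟦ q ⟧ λ I qI≢0 → cong g (unionOver-pull qI≢0))

    q⁺-bal : PairBalanced q⁺
    q⁺-bal u v = trans (q⁺-· (separation-grounded u v))
      (trans (·-congʳ ⟦ q ⟧ λ I _ → cong (if_then 1# else 0#) (cong₂ _xor_ (side-pull φ refl I u) (side-pull φ refl I v))) (q-bal (φ u) (φ v)))

    q⁺-valid : ∀ S → H (suc n) S → 0# ≤ q⁺ ∙ S
    q⁺-valid S HS = let S′ , HS′ , agree = H-pull φ refl HS in
      subst (0# ≤_) (trans (∙-· q S′) (trans (·-congʳ ⟦ q ⟧ λ I qI≢0 → agree I (pull-φ-nonempty qI≢0))
        (trans (sym (q⁺-· (⟦⟧-grounded S))) (sym (∙-· q⁺ S))))) (proj₁ q-facet S′ HS′)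

    nonzero : ∃[ I ] ⟦ q ⟧ I ≢ 0#
    nonzero = facet-nonzero q q-bal q-facet

    -- On the support of `q`, `pull ψ` undoes `pull φ`, so pairing `q⁺` with `δ I₀ ∘ pull ψ`
    -- recovers the coefficient of `q` at `I₀`.
    q⁺-nonzero : ∃[ J ] ⟦ q⁺ ⟧ J ≢ 0#
    q⁺-nonzero = decidable-stable (excluded-middle _) λ q⁺≡0 → proj₂ nonzero (begin
      ⟦ q ⟧ I₀                               ≡⟨ ·-δ ⟦ q ⟧ I₀ ⟨
      ⟦ q ⟧ · δ I₀                           ≡⟨ ·-congʳ ⟦ q ⟧ (λ I qI≢0 → cong (δ I₀) (sym (pull-retract qI≢0))) ⟩
      ⟦ q ⟧ · (δ I₀ ∘ pull ψ ∘ pull φ)       ≡⟨ q⁺-· (λ J J≡∅ → δ-grounded I₀ I₀≢∅ (pull ψ J) (J≡∅ ∘ pull-nonempty ψ J)) ⟨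
      ⟦ q⁺ ⟧ · (δ I₀ ∘ pull ψ)               ≡⟨ sumSubsets-zero (suc n) (λ J → vanishing q⁺≡0 J) ⟩
      0#                                     ∎)
      where
      open ≡-Reasoning
      I₀ = proj₁ nonzero
      I₀≢∅ = ⟦⟧-nonempty q (proj₂ nonzero)
      vanishing : ¬ (∃[ J ] ⟦ q⁺ ⟧ J ≢ 0#) → ∀ J → ⟦ q⁺ ⟧ J * δ I₀ (pull ψ J) ≡ 0#
      vanishing q⁺≡0 J = trans (cong (_* δ I₀ (pull ψ J)) (decidable-stable (⟦ q⁺ ⟧ J ≟ℝ 0#) λ q⁺J≢0 → q⁺≡0 (J , q⁺J≢0))) (zeroˡ _)

    -- The support of `q⁺` consists of preimages under `φ`, and these do not separate terminals with
    -- the same image.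
    q⁺-saturated : ∀ u v → φ u ≡ φ v → ∀ J → ⟦ q⁺ ⟧ J ≢ 0# → side J u ≡ side J v
    q⁺-saturated u v φu≡φv J q⁺J≢0 = decidable-stable (side J u Bool.≟ side J v) λ u≢v → q⁺J≢0 (begin
      ⟦ q⁺ ⟧ J                  ≡⟨ ·-δ ⟦ q⁺ ⟧ J ⟨
      ⟦ q⁺ ⟧ · δ J              ≡⟨ q⁺-· (δ-grounded J (⟦⟧-nonempty q⁺ q⁺J≢0)) ⟩
      ⟦ q ⟧ · (δ J ∘ pull φ)    ≡⟨ sumSubsets-zero n (λ I → trans (cong (⟦ q ⟧ I *_) (δ-distinct {J = J} {pull φ I} (u≢v ∘ together I))) (zeroʳ (⟦ q ⟧ I))) ⟩
      0#                        ∎)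
      where
      open ≡-Reasoning
      together : ∀ I → J ≡ pull φ I → side J u ≡ side J v
      together I refl = trans (side-pull φ refl I u) (trans (cong (side I) φu≡φv) (sym (side-pull φ refl I v)))

    module _ (r : Subset (suc n) → ℝ) (r∅ : Grounded r) (r⊥ : Annihilates r (Face q⁺)) where

      r-split : ∀ s t J → φ (just s) ≡ φ t → lookup J s ≡ true → side J t ≡ false → r J ≡ 0#
      r-split s t J φs≡φt = face-annihilator-vanishes q⁺ q⁺-bal s t (q⁺-saturated (just s) t φs≡φt) r r⊥ J

      -- `j` and `ψ (φ (just j))` have the same image under `φ`, so by `r-split` no `J` with
      -- `r J ≢ 0#` separates them in either direction.
      r-saturated : ∀ J → r J ≢ 0# → pull φ (pull ψ J) ≡ J
      r-saturated J rJ≢0 = side-injective λ j → trans (side-pull φ refl (pull ψ J) (just j))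
        (trans (side-pull ψ refl J (φ (just j))) (true-iff (back j) (forth j)))
        where
        forth : ∀ j → lookup J j ≡ true → side J (ψ (φ (just j))) ≡ true
        forth j j∈J = decidable-stable (_ Bool.≟ true) λ v∉J →
          rJ≢0 (r-split j (ψ (φ (just j))) J (sym (φψφ (just j))) j∈J (Bool.¬-not v∉J))
        back : ∀ j → side J (ψ (φ (just j))) ≡ true → lookup J j ≡ true
        back j v∈J = decidable-stable (_ Bool.≟ true) λ j∉J → let s , v≡s , s∈J = ∈-side (ψ (φ (just j))) v∈J in
          rJ≢0 (r-split s (just j) J (trans (cong φ (sym v≡s)) (φψφ (just j))) s∈J (Bool.¬-not j∉J))

      -- `r` as a functional on the smaller space. Nothing is lost, since `pull φ` recovers `J` from
      -- `pull ψ J` wherever `r J` is nonzero.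
      ρ : Vector n
      ρ = substituteTerms (pull ψ) (r ∘ value)

      ⟦r⟧ : ∀ J → ⟦ r ∘ value ⟧ J ≡ r J
      ⟦r⟧ J with nonempty? J
      ... | yes _   = refl
      ... | no J≡∅  = sym (r∅ J J≡∅)

      ρ-· : ∀ {g} → Grounded g → ⟦ ρ ⟧ · g ≡ r · (g ∘ pull ψ)
      ρ-· {g} g∅ = trans (substituteTerms-· (pull ψ) (r ∘ value) g∅) (sumSubsets-cong (suc n) λ J → cong (_* g (pull ψ J)) (⟦r⟧ J))

      pull-ψ-nonempty : ∀ J → r J ≢ 0# → Nonempty (pull ψ J)
      pull-ψ-nonempty J rJ≢0 = pull-nonempty φ (pull ψ J) (subst Nonempty (sym (r-saturated J rJ≢0))
        (decidable-stable (nonempty? J) λ J≡∅ → rJ≢0 (r∅ J J≡∅)))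

      -- Placed on representatives, the network for `S` yields an `S′` with which `r` pairs as `ρ`
      -- does with `S`. It lies on the face of `q⁺` because `pull ψ` undoes `pull φ` on the support
      -- of `q`.
      ρ-annihilates : Annihilates ⟦ ρ ⟧ (Face q)
      ρ-annihilates S (HS , q∙S≡0) = let S′ , HS′ , agree = H-pull ψ refl HS in begin
        ⟦ ρ ⟧ · ⟦ S ⟧             ≡⟨ ρ-· (⟦⟧-grounded S) ⟩
        r · (⟦ S ⟧ ∘ pull ψ)      ≡⟨ ·-congʳ r (λ J rJ≢0 → agree J (pull-ψ-nonempty J rJ≢0)) ⟨
        r · ⟦ S′ ⟧                ≡⟨ r⊥ S′ (HS′ , facial S′ agree) ⟩
        0#                        ∎
        where
        open ≡-Reasoning
        facial : ∀ S′ → (∀ J → Nonempty (pull ψ J) → ⟦ S′ ⟧ J ≡ ⟦ S ⟧ (pull ψ J)) → q⁺ ∙ S′ ≡ 0#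
        facial S′ agree = trans (∙-· q⁺ S′) (trans (q⁺-· (⟦⟧-grounded S′)) (trans
          (·-congʳ ⟦ q ⟧ λ I qI≢0 → trans (agree (pull φ I) (subst Nonempty (sym (pull-retract qI≢0)) (⟦⟧-nonempty q qI≢0))) (cong ⟦ S ⟧ (pull-retract qI≢0)))
          (trans (sym (∙-· q S)) q∙S≡0)))

      -- Pairing with `δ J ∘ pull φ` turns `ρ` into `r J` and `q` into the coefficient of `q⁺` at
      -- `J`, so the factor for `ρ` serves for `r`.
      r-multiple : Multiple r q⁺
      r-multiple = let l , ρ≡lq = face-annihilator-multiple q q-facet nonzero ⟦ ρ ⟧ (⟦⟧-grounded ρ) ρ-annihilates in l , scaled l ρ≡lq
        where
        open ≡-Reasoning
        scaled : ∀ l → (∀ I → ⟦ ρ ⟧ I ≡ l * ⟦ q ⟧ I) → ∀ J → r J ≡ l * ⟦ q⁺ ⟧ J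
        scaled l ρ≡lq J with nonempty? J
        ... | no J≡∅  = trans (r∅ J J≡∅) (sym (zeroʳ l))
        ... | yes J≢∅ = begin
          r J                                ≡⟨ ·-δ r J ⟨
          r · δ J                            ≡⟨ ·-congʳ r (λ I rI≢0 → cong (δ J) (sym (r-saturated I rI≢0))) ⟩
          r · (δ J ∘ pull φ ∘ pull ψ)        ≡⟨ ρ-· (λ I I≡∅ → δ-grounded J J≢∅ (pull φ I) (I≡∅ ∘ pull-nonempty φ I)) ⟨
          ⟦ ρ ⟧ · (δ J ∘ pull φ)             ≡⟨ sumSubsets-cong n (λ I → trans (cong (_* δ J (pull φ I)) (ρ≡lq I)) (*-assoc l (⟦ q ⟧ I) (δ J (pull φ I)))) ⟩
          sumSubsets n (λ I → l * (⟦ q ⟧ I * δ J (pull φ I)))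
                                             ≡⟨ sumSubsets-*ˡ l (λ I → ⟦ q ⟧ I * δ J (pull φ I)) ⟩
          l * (⟦ q ⟧ · (δ J ∘ pull φ))       ≡⟨ cong (l *_) (q⁺-· (δ-grounded J J≢∅)) ⟨
          l * (⟦ q⁺ ⟧ · δ J)                 ≡⟨ cong (l *_) (trans (·-δ ⟦ q⁺ ⟧ J) (⟦⟧-value q⁺ (J , [ J≢∅ ]))) ⟩
          l * q⁺ (J , [ J≢∅ ])               ∎

    zeroLift-facet : Superbalanced q⁺ × IsFacet q⁺
    zeroLift-facet = pairBalanced⇒superbalanced q⁺ q⁺-bal , facet-criterion q⁺ q⁺-nonzero q⁺-valid r-multiple

theorem5 : (R : Reals) → let open Cuts R in
    ∀ (n : ℕ) .{{_ : NonZero n}} (q : Vector n) →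
    Superbalanced q × IsFacet q →
    ∀ (F : Fin n → Subset (suc n)) → LiftFamily q F →
    Superbalanced (zeroLift F q) × IsFacet (zeroLift F q)
theorem5 R n q (q-bal , q-facet) F F-family = zeroLift-facet q (superbalanced⇒pairBalanced q q-bal) q-facet F F-family
  where
  open ZeroLifts R
  open Lift
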